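{- Let $\epsilon>0$ be fixed. Let $d,k$ be integers with $d<2^{\epsilon k/5}$, and let $f:(\mathbb{F}_2^k)^d\to\mathbb{F}_2$ be a uniformly random $d$-linear form. Then $$\Pr\left[\mathrm{bias}(f)\ge 2^{ -(1-\epsilon)k}\right]\le 2^{ -\Omega(\epsilon^2k^d)}.$$
   Context: A $d$-linear form $f:(\mathbb{F}_2^k)^d\to\mathbb{F}_2$ is a map linear in each of its $d$ arguments, i.e. $f(x_1,\dots,x_d)=\sum_{(i_1,\dots,i_d)\in[k]^d}T(i_1,\dots,i_d)\,x_{1,i_1}\cdots x_{d,i_d}$ for a tensor $T:[k]^d\to\mathbb{F}_2$; uniformly random means all entries of $T$ are independent uniform bits. $\mathrm{bias}(f)=\left|\mathbb{E}_{x_1,\dots,x_d\in\mathbb{F}_2^k}(-1)^{f(x_1,\dots,x_d)}\right|$. The $\Omega(\cdot)$ hides an absolute positive constant. -}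

module Defs where

open import Data.Bool using (Bool; true; false; _∧_; _xor_)
open import Data.Nat using (ℕ; zero; suc; _^_)
open import Data.Fin using (Fin; zero; suc; funToFin)
open import Data.List using (List; []; _∷_; map; concatMap; foldr; allFin)
open import Data.Integer using (ℤ; +_; -_)
import Data.Integer as ℤ

-- F₂ is modelled by Bool (addition = xor, multiplication = ∧).
𝔽₂ : List Bool
𝔽₂ = false ∷ true ∷ []

-- All functions Fin n → A whose values range over the given list
-- (each function listed exactly once when the list has no duplicates).
allFuns : {A : Set} → (n : ℕ) → List A → List (Fin n → A)
allFuns zero    xs = (λ ()) ∷ []
allFuns (suc n) xs =
  concatMap (λ a → map (λ g → λ { zero → a ; (suc i) → g i }) (allFuns n xs)) xs

Vec𝔽₂ : ℕ → Set
Vec𝔽₂ k = Fin k → Bool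

-- A tensor T : [k]^d → 𝔽₂, stored as a function on Fin (k ^ d); the index
-- (i₁,…,i_d) ∈ [k]^d is sent to Fin (k ^ d) by the stdlib bijection funToFin.
Tensor : ℕ → ℕ → Set
Tensor d k = Fin (k ^ d) → Bool

entry : (d k : ℕ) → Tensor d k → (Fin d → Fin k) → Bool
entry d k T i = T (funToFin i)

-- All 2^(k^d) tensors (the sample space of a uniformly random d-linear form).
allTensors : (d k : ℕ) → List (Tensor d k)
allTensors d k = allFuns (k ^ d) 𝔽₂

sum𝔽₂ : List Bool → Bool
sum𝔽₂ = foldr _xor_ false

prod𝔽₂ : List Bool → Bool
prod𝔽₂ = foldr _∧_ true

form : (d k : ℕ) → Tensor d k → (Fin d → Vec𝔽₂ k) → Bool
form d k T x =
  sum𝔽₂ (map (λ i → entry d k T i ∧ prod𝔽₂ (map (λ j → x j (i j)) (allFin d)))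
              (allFuns d (allFin k)))

sign : Bool → ℤ
sign false = + 1
sign true  = - (+ 1)

sumℤ : List ℤ → ℤ
sumℤ = foldr ℤ._+_ (+ 0)

-- Σ_{x₁,…,x_d ∈ 𝔽₂^k} (-1)^{f(x₁,…,x_d)}.  Hence
--   bias(f) = ∣ biasSum d k T ∣ / 2^(k·d).
biasSum : (d k : ℕ) → Tensor d k → ℤ
biasSum d k T = sumℤ (map (λ x → sign (form d k T x)) (allFuns d (allFuns k 𝔽₂)))

{-# OPTIONS --safe #-}
-- Expanding one of the d arguments, bias(f) is the probability that X = x₂ ⊗ ⋯ ⊗ x_d is orthogonal
-- to all k slices of the tensor.  Hence the t-th moment of the bias of a random form is
-- E 2^(-k rank (X₁, …, X_t)), and Markov's inequality reduces the theorem to a bound, for a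
-- subgroup V of dimension r < t ≈ ε k^(d-1), on the probability that X ∈ V:
--   Pr [X ∈ V]  ≤  (d-1) 2^(a₀-k) + (r / k^(d-1))^m,    a₀ ≈ ε k / 5.
-- This goes by induction on d.  Let s(x) be the dimension of V_x = {w : x ⊗ w ∈ V} and choose a
-- basis b₁, b₂, … of 𝔽₂ᵏ greedily, each bⱼ maximizing s outside the span of its predecessors.
-- Then Σ s(bⱼ) ≤ r, and x falls in the span of the first a₀ vectors with probability 2^(a₀-k).  For
-- the other x the average of s(x)^m is at most (r / k)^m, because s is a nonnegative combination
-- of indicators of initial segments [1, a], and these satisfy 2^(a-k) ≤ (a / k)^m for a₀ ≤ a ≤ k.
module Submission where

open import Defs
open import Data.Nat
open import Data.Integer using (ℤ; -_; ∣_∣) renaming (+_ to pos)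
open import Data.List using (List; []; _∷_; _++_; map; length; filter; filterᵇ; cartesianProductWith; concatMap; allFin)
open import Data.Product using (Σ; ∃; _×_; _,_; proj₁; proj₂)

open import Algebra.Bundles using (CommutativeRing)
import Data.Bool
open import Data.Bool using (Bool; true; false; _∧_; _xor_; not; if_then_else_)
open import Data.Bool.ListAction using (all)
import Data.Bool.Properties as Bool
open import Data.Fin using (Fin; zero; suc; combine; funToFin; _↑ˡ_; _↑ʳ_)
import Data.Integer as ℤ
import Data.Integer.Properties as ℤ
open import Data.List.Properties using (length-map; length-++; map-cong; map-∘; map-++; map-tabulate)
open import Data.List.Membership.Propositional using (_∈_; _∉_)
open import Data.List.Membership.Propositional.Properties
open import Data.List.Relation.Unary.All as All using ([]; _∷_)
open import Data.List.Relation.Unary.AllPairs using ([]; _∷_)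
open import Data.List.Relation.Unary.Any using (here; there; any?)
open import Data.List.Relation.Unary.Unique.Propositional using (Unique)
import Data.List.Relation.Unary.Unique.Propositional.Properties as Unique
open import Data.Nat.DivMod using (_/_; m≡m%n+[m/n]*n; m%n<n; m/n*n≤m)
open import Data.Nat.Induction using (<-rec)
open import Data.Nat.Logarithm
open import Data.Nat.Properties
open import Data.Nat.Tactic.RingSolver using (solve-∀)
open import Data.List.Extrema ≤-totalOrder using (argmax; f[xs]≤f[argmax]; f[⊥]≤f[argmax]; argmax-all)
open import Data.Sum using (_⊎_; inj₁; inj₂)
open import Data.Vec as Vec using (Vec; []; _∷_; zipWith; replicate; take; drop; tabulate)
open import Data.Vec.Properties using (∷-injective; take-zipWith; drop-zipWith; take++drop≡id; ++-injective; zipWith-++)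
import Data.Vec.Properties as Vec
open import Function using (_∘_; id)
open import Relation.Nullary using (Dec; yes; no; ¬?; contradiction)
open import Relation.Binary.PropositionalEquality

import Algebra.Properties.CommutativeSemigroup +-commutativeSemigroup as ℕ+
import Algebra.Properties.CommutativeSemigroup *-commutativeSemigroup as ℕ*
import Algebra.Properties.CommutativeSemigroup ℤ.+-commutativeSemigroup as ℤ+
open import Algebra.Properties.CommutativeSemigroup
  (CommutativeRing.+-commutativeSemigroup Bool.xor-∧-commutativeRing)
  using () renaming (interchange to xor-interchange)

-- The power (r / k^(d-1))^m is modelled on V = L ⊗ 𝔽₂^(k^(d-2)) with dim L = a: here r / k^(d-1) =
-- a / k, and X ∈ V as soon as x₂ ∈ L, which has probability 2^(a-k). A power is multiplicative, so
-- the bound for V_x averages to the bound for V with the same m at every level. It is too small for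
-- a near 0, where (a / k)^m drops below 2^(a-k); hence each of the d-1 levels gives up the span of
-- a₀ vectors. The exponent m is, up to rounding, the largest with 2^(a₀-k) ≤ (a₀ / k)^m, that is,
-- about (k - a₀) / log₂ (k / a₀). Markov then bounds the probability by ((1 + d 2^a₀) 2^(-εk))^t.
-- For d ≥ 2 the factor 1 + d 2^a₀ is at most d² 2^a₀ ≤ 2^(3εk/5), by the hypothesis on d and the
-- choice of a₀, so 2^(-2εkt/5) remains. Throughout, ε = p / q, probabilities are counts with
-- denominators cleared, and rational exponents appear as q-th powers.

private variable
  A B C : Set
  n k : ℕ

-- Finite sums, indicators and the cube 𝔽₂ⁿ

∑ : List A → (A → ℕ) → ℕ
∑ []       f = 0
∑ (x ∷ xs) f = f x + ∑ xs f

∑-cong : ∀ (xs : List A) {f g : A → ℕ} → (∀ x → f x ≡ g x) → ∑ xs f ≡ ∑ xs g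
∑-cong []       f≗g = refl
∑-cong (x ∷ xs) f≗g = cong₂ _+_ (f≗g x) (∑-cong xs f≗g)

∑-mono : ∀ (xs : List A) {f g : A → ℕ} → (∀ x → f x ≤ g x) → ∑ xs f ≤ ∑ xs g
∑-mono []       f≤g = z≤n
∑-mono (x ∷ xs) f≤g = +-mono-≤ (f≤g x) (∑-mono xs f≤g)

∑-mono-∈ : ∀ (xs : List A) {f g : A → ℕ} → (∀ {x} → x ∈ xs → f x ≤ g x) → ∑ xs f ≤ ∑ xs g
∑-mono-∈ []       f≤g = z≤n
∑-mono-∈ (x ∷ xs) f≤g = +-mono-≤ (f≤g (here refl)) (∑-mono-∈ xs (f≤g ∘ there))

∑-const : ∀ (xs : List A) c → ∑ xs (λ _ → c) ≡ length xs * c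
∑-const []       c = refl
∑-const (x ∷ xs) c = cong (c +_) (∑-const xs c)

∑-+ : ∀ (xs : List A) (f g : A → ℕ) → ∑ xs (λ x → f x + g x) ≡ ∑ xs f + ∑ xs g
∑-+ []       f g = refl
∑-+ (x ∷ xs) f g = trans (cong (f x + g x +_) (∑-+ xs f g)) (ℕ+.interchange (f x) (g x) _ _)

∑-*ˡ : ∀ (xs : List A) c (f : A → ℕ) → ∑ xs (λ x → c * f x) ≡ c * ∑ xs f
∑-*ˡ []       c f = sym (*-zeroʳ c)
∑-*ˡ (x ∷ xs) c f = trans (cong (c * f x +_) (∑-*ˡ xs c f)) (sym (*-distribˡ-+ c (f x) _))

∑-*ʳ : ∀ (xs : List A) c (f : A → ℕ) → ∑ xs (λ x → f x * c) ≡ ∑ xs f * c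
∑-*ʳ xs c f = trans (∑-cong xs (λ x → *-comm (f x) c)) (trans (∑-*ˡ xs c f) (*-comm c _))

∑-swap : ∀ (xs : List A) (ys : List B) (f : A → B → ℕ) →
         ∑ xs (λ x → ∑ ys (f x)) ≡ ∑ ys (λ y → ∑ xs (λ x → f x y))
∑-swap []       ys f = sym (trans (∑-const ys 0) (*-zeroʳ (length ys)))
∑-swap (x ∷ xs) ys f = trans (cong (∑ ys (f x) +_) (∑-swap xs ys f))
                             (sym (∑-+ ys (f x) _))

∑-++ : ∀ (xs ys : List A) (f : A → ℕ) → ∑ (xs ++ ys) f ≡ ∑ xs f + ∑ ys f
∑-++ []       ys f = refl
∑-++ (x ∷ xs) ys f = trans (cong (f x +_) (∑-++ xs ys f)) (sym (+-assoc (f x) _ _))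

∑-map : ∀ (g : A → B) (xs : List A) (f : B → ℕ) → ∑ (map g xs) f ≡ ∑ xs (f ∘ g)
∑-map g []       f = refl
∑-map g (x ∷ xs) f = cong (f (g x) +_) (∑-map g xs f)

∑-cartesianProductWith : ∀ (h : A → B → C) xs ys (f : C → ℕ) →
  ∑ (cartesianProductWith h xs ys) f ≡ ∑ xs (λ x → ∑ ys (f ∘ h x))
∑-cartesianProductWith h []       ys f = refl
∑-cartesianProductWith h (x ∷ xs) ys f =
  trans (∑-++ (map (h x) ys) _ f)
        (cong₂ _+_ (∑-map (h x) ys f) (∑-cartesianProductWith h xs ys f))

⟦_⟧ : Bool → ℕ
⟦ b ⟧ = if b then 1 else 0

⟦⟧-∧ : ∀ a b → ⟦ a ∧ b ⟧ ≡ ⟦ a ⟧ * ⟦ b ⟧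
⟦⟧-∧ false b = refl
⟦⟧-∧ true  b = sym (+-identityʳ ⟦ b ⟧)

⟦⟧≤1 : ∀ b → ⟦ b ⟧ ≤ 1
⟦⟧≤1 false = z≤n
⟦⟧≤1 true  = ≤-refl

-- Vectors replace the functions of the statement: entrywise equal vectors are equal, and equality
-- of bit vectors is decidable, which membership in spans relies on.
vecs : ∀ n → List A → List (Vec A n)
vecs zero    xs = [] ∷ []
vecs (suc n) xs = cartesianProductWith _∷_ xs (vecs n xs)

cube : ∀ n → List (Vec Bool n)
cube n = vecs n 𝔽₂

∑-vecs : ∀ n (xs : List A) (f : Vec A (suc n) → ℕ) →
         ∑ (vecs (suc n) xs) f ≡ ∑ xs (λ x → ∑ (vecs n xs) (λ v → f (x ∷ v)))
∑-vecs n xs f = ∑-cartesianProductWith _∷_ xs (vecs n xs) f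

length-cartesianProductWith : ∀ (h : A → B → C) xs ys →
  length (cartesianProductWith h xs ys) ≡ length xs * length ys
length-cartesianProductWith h xs ys = begin
  length (cartesianProductWith h xs ys)           ≡⟨ *-identityʳ _ ⟨
  length (cartesianProductWith h xs ys) * 1       ≡⟨ ∑-const (cartesianProductWith h xs ys) 1 ⟨
  ∑ (cartesianProductWith h xs ys) (λ _ → 1)      ≡⟨ ∑-cartesianProductWith h xs ys _ ⟩
  ∑ xs (λ _ → ∑ ys (λ _ → 1))                     ≡⟨ ∑-const xs _ ⟩
  length xs * ∑ ys (λ _ → 1)                      ≡⟨ cong (length xs *_) (trans (∑-const ys 1) (*-identityʳ _)) ⟩
  length xs * length ys                           ∎
  where open ≡-Reasoning

length-vecs : ∀ n (xs : List A) → length (vecs n xs) ≡ length xs ^ n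
length-vecs zero    xs = refl
length-vecs (suc n) xs =
  trans (length-cartesianProductWith _∷_ xs (vecs n xs)) (cong (length xs *_) (length-vecs n xs))

∈-cube : ∀ (v : Vec Bool n) → v ∈ cube n
∈-cube []          = here refl
∈-cube (false ∷ v) = ∈-cartesianProductWith⁺ _∷_ {xs = 𝔽₂} (here refl) (∈-cube v)
∈-cube (true  ∷ v) = ∈-cartesianProductWith⁺ _∷_ {xs = 𝔽₂} (there (here refl)) (∈-cube v)

cube-unique : ∀ n → Unique (cube n)
cube-unique zero    = [] ∷ []
cube-unique (suc n) =
  Unique.cartesianProductWith⁺ _∷_ ∷-injective (((λ ()) ∷ []) ∷ [] ∷ []) (cube-unique n)

-- Linear algebra over 𝔽₂

infixl 6 _⊕_

_⊕_ : Vec Bool n → Vec Bool n → Vec Bool n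
_⊕_ = zipWith _xor_

0⃗ : Vec Bool n
0⃗ = replicate _ false

⊕-self : (u : Vec Bool n) → u ⊕ u ≡ 0⃗
⊕-self []      = refl
⊕-self (a ∷ u) = cong₂ _∷_ (Bool.xor-same a) (⊕-self u)

⊕-identityʳ : (u : Vec Bool n) → u ⊕ 0⃗ ≡ u
⊕-identityʳ []      = refl
⊕-identityʳ (a ∷ u) = cong₂ _∷_ (Bool.xor-identityʳ a) (⊕-identityʳ u)

⊕-identityˡ : (u : Vec Bool n) → 0⃗ ⊕ u ≡ u
⊕-identityˡ []      = refl
⊕-identityˡ (a ∷ u) = cong (a ∷_) (⊕-identityˡ u)

⊕-assoc : (u v w : Vec Bool n) → u ⊕ v ⊕ w ≡ u ⊕ (v ⊕ w)
⊕-assoc []      []      []      = refl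
⊕-assoc (a ∷ u) (b ∷ v) (c ∷ w) = cong₂ _∷_ (Bool.xor-assoc a b c) (⊕-assoc u v w)

⊕-cancelʳ : (u v : Vec Bool n) → u ⊕ v ⊕ v ≡ u
⊕-cancelʳ u v = trans (⊕-assoc u v v) (trans (cong (u ⊕_) (⊕-self v)) (⊕-identityʳ u))

⊕-comm : (u v : Vec Bool n) → u ⊕ v ≡ v ⊕ u
⊕-comm []      []      = refl
⊕-comm (a ∷ u) (b ∷ v) = cong₂ _∷_ (Bool.xor-comm a b) (⊕-comm u v)

dot : Vec Bool n → Vec Bool n → Bool
dot []      []      = false
dot (a ∷ u) (b ∷ v) = (a ∧ b) xor dot u v

dot-⊕ʳ : (u v w : Vec Bool n) → dot u (v ⊕ w) ≡ dot u v xor dot u w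
dot-⊕ʳ []      []      []      = refl
dot-⊕ʳ (a ∷ u) (b ∷ v) (c ∷ w) =
  trans (cong₂ _xor_ (Bool.∧-distribˡ-xor a b c) (dot-⊕ʳ u v w)) (xor-interchange (a ∧ b) (a ∧ c) _ _)

dot-comm : (u v : Vec Bool n) → dot u v ≡ dot v u
dot-comm []      []      = refl
dot-comm (a ∷ u) (b ∷ v) = cong₂ _xor_ (Bool.∧-comm a b) (dot-comm u v)

dot-⊕ˡ : (u v w : Vec Bool n) → dot (u ⊕ v) w ≡ dot u w xor dot v w
dot-⊕ˡ u v w = trans (dot-comm (u ⊕ v) w)
  (trans (dot-⊕ʳ w u v) (cong₂ _xor_ (dot-comm w u) (dot-comm w v)))

dot-0ˡ : (v : Vec Bool n) → dot 0⃗ v ≡ false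
dot-0ˡ []      = refl
dot-0ˡ (_ ∷ v) = dot-0ˡ v

dot-0ʳ : (v : Vec Bool n) → dot v 0⃗ ≡ false
dot-0ʳ v = trans (dot-comm v 0⃗) (dot-0ˡ v)

dot-nondegenerate : (u v : Vec Bool n) → (∀ w → dot u w ≡ dot v w) → u ≡ v
dot-nondegenerate []      []      eq = refl
dot-nondegenerate (a ∷ u) (b ∷ v) eq = cong₂ _∷_
  (begin
     a                            ≡⟨ Bool.xor-identityʳ a ⟨
     a xor false                  ≡⟨ cong₂ _xor_ (Bool.∧-identityʳ a) (dot-0ʳ u) ⟨
     (a ∧ true) xor dot u 0⃗       ≡⟨ eq (true ∷ 0⃗) ⟩
     (b ∧ true) xor dot v 0⃗       ≡⟨ cong₂ _xor_ (Bool.∧-identityʳ b) (dot-0ʳ v) ⟩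
     b xor false                  ≡⟨ Bool.xor-identityʳ b ⟩
     b                            ∎)
  (dot-nondegenerate u v λ w → begin
     dot u w                      ≡⟨ cong (_xor dot u w) (Bool.∧-zeroʳ a) ⟨
     (a ∧ false) xor dot u w      ≡⟨ eq (false ∷ w) ⟩
     (b ∧ false) xor dot v w      ≡⟨ cong (_xor dot v w) (Bool.∧-zeroʳ b) ⟩
     dot v w                      ∎)
  where open ≡-Reasoning

∑-cube-suc : ∀ n (f : Vec Bool (suc n) → ℕ) →
  ∑ (cube (suc n)) f ≡ ∑ (cube n) (f ∘ (false ∷_)) + ∑ (cube n) (f ∘ (true ∷_))
∑-cube-suc n f = trans (∑-vecs n 𝔽₂ f)
  (cong (∑ (cube n) (f ∘ (false ∷_)) +_) (+-identityʳ _))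

-- Translation permutes the cube coordinate by coordinate; a leading `true` swaps the two halves.
∑-cube-translate : (u : Vec Bool n) (f : Vec Bool n → ℕ) →
  ∑ (cube n) (λ v → f (v ⊕ u)) ≡ ∑ (cube n) f
∑-cube-translate {zero}  []          f = refl
∑-cube-translate {suc n} (false ∷ u) f = trans (∑-cube-suc n _)
  (trans (cong₂ _+_ (∑-cube-translate u (f ∘ (false ∷_))) (∑-cube-translate u (f ∘ (true ∷_))))
         (sym (∑-cube-suc n f)))
∑-cube-translate {suc n} (true ∷ u) f = trans (∑-cube-suc n _)
  (trans (cong₂ _+_ (∑-cube-translate u (f ∘ (true ∷_))) (∑-cube-translate u (f ∘ (false ∷_))))
  (trans (+-comm (∑ (cube n) (f ∘ (true ∷_))) _) (sym (∑-cube-suc n f))))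

-- Subgroups of 𝔽₂ⁿ, that is subspaces, and their orthogonal complements

record Subgroup (V : Vec Bool n → Bool) : Set where
  field
    0∈ : V 0⃗ ≡ true
    ⊕∈ : ∀ {u v} → V u ≡ true → V v ≡ true → V (u ⊕ v) ≡ true

open Subgroup public

size : (Vec Bool n → Bool) → ℕ
size {n} V = ∑ (cube n) (λ v → ⟦ V v ⟧)

⟦⟧-mono : ∀ {a b} → (a ≡ true → b ≡ true) → ⟦ a ⟧ ≤ ⟦ b ⟧
⟦⟧-mono {false} _ = z≤n
⟦⟧-mono {true} f rewrite f refl = ≤-refl

⟦⟧-cong : ∀ {a b} → (a ≡ true → b ≡ true) → (b ≡ true → a ≡ true) → ⟦ a ⟧ ≡ ⟦ b ⟧
⟦⟧-cong f g = ≤-antisym (⟦⟧-mono f) (⟦⟧-mono g)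

-- Translation by a vector of U not orthogonal to v pairs off the two halves of U.
module _ {U : Vec Bool n → Bool} (sg : Subgroup U) (v : Vec Bool n) where

  translate-∈ : ∀ {u₀} → U u₀ ≡ true → ∀ u → ⟦ U (u ⊕ u₀) ⟧ ≡ ⟦ U u ⟧
  translate-∈ {u₀} u₀∈ u = ⟦⟧-cong
    (λ p → subst (λ z → U z ≡ true) (⊕-cancelʳ u u₀) (⊕∈ sg p u₀∈))
    (λ p → ⊕∈ sg p u₀∈)

  half-size : ∀ {u₀} → U u₀ ≡ true → dot u₀ v ≡ true →
    2 * size (λ u → U u ∧ not (dot u v)) ≡ size U
  half-size {u₀} u₀∈ u₀v = begin
    2 * ∑ c f                                ≡⟨ cong (∑ c f +_) (+-identityʳ _) ⟩
    ∑ c f + ∑ c f                            ≡⟨ cong (∑ c f +_) (∑-cube-translate u₀ f) ⟨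
    ∑ c f + ∑ c (λ u → f (u ⊕ u₀))           ≡⟨ ∑-+ c f _ ⟨
    ∑ c (λ u → f u + f (u ⊕ u₀))             ≡⟨ ∑-cong c pair ⟩
    size U                                   ∎
    where
    open ≡-Reasoning
    c = cube n
    f : Vec Bool n → ℕ
    f u = ⟦ U u ∧ not (dot u v) ⟧
    split : ∀ a → ⟦ not a ⟧ + ⟦ not (a xor true) ⟧ ≡ 1
    split false = refl
    split true  = refl
    pair : ∀ u → f u + f (u ⊕ u₀) ≡ ⟦ U u ⟧
    pair u rewrite ⟦⟧-∧ (U u) (not (dot u v)) | ⟦⟧-∧ (U (u ⊕ u₀)) (not (dot (u ⊕ u₀) v))
                 | translate-∈ u₀∈ u | dot-⊕ˡ u u₀ v | u₀v =
      trans (sym (*-distribˡ-+ ⟦ U u ⟧ _ _))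
            (trans (cong (⟦ U u ⟧ *_) (split (dot u v))) (*-identityʳ _))

∧-true : ∀ {a b} → a ∧ b ≡ true → a ≡ true × b ≡ true
∧-true {true} {true} _ = refl , refl

all-intro : ∀ (f : A → Bool) xs → (∀ x → f x ≡ true) → all f xs ≡ true
all-intro f []       h = refl
all-intro f (x ∷ xs) h rewrite h x = all-intro f xs h

all-elim : ∀ (f : A → Bool) {x xs} → all f xs ≡ true → x ∈ xs → f x ≡ true
all-elim f h (here refl) = proj₁ (∧-true h)
all-elim f {xs = y ∷ _} h (there x∈) = all-elim f (proj₂ (∧-true {f y} h)) x∈

all-false : ∀ (f : A → Bool) xs → all f xs ≡ false → ∃ λ x → f x ≡ false
all-false f (x ∷ xs) h with f x in eq
... | false = x , eq
... | true  = all-false f xs h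

perp : (Vec Bool n → Bool) → Vec Bool n → Bool
perp {n} U v = all (λ u → not (U u ∧ dot u v)) (cube n)

restrict : (Vec Bool n → Bool) → Vec Bool n → Vec Bool n → Bool
restrict U v u = U u ∧ not (dot u v)

perp-intro : ∀ (U : Vec Bool n → Bool) v → (∀ u → U u ≡ true → dot u v ≡ false) → perp U v ≡ true
perp-intro {n} U v h = all-intro _ (cube n) go
  where
  go : ∀ u → not (U u ∧ dot u v) ≡ true
  go u with U u in eq
  ... | false = refl
  ... | true  = cong not (h u eq)

perp-elim : ∀ (U : Vec Bool n → Bool) v → perp U v ≡ true → ∀ u → U u ≡ true → dot u v ≡ false
perp-elim U v h u u∈ with all-elim (λ u → not (U u ∧ dot u v)) h (∈-cube u)
... | p rewrite u∈ with dot u v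
...   | false = refl

perp-witness : ∀ (U : Vec Bool n → Bool) v → perp U v ≡ false → ∃ λ u → U u ≡ true × dot u v ≡ true
perp-witness {n} U v h with all-false _ (cube n) h
... | u , p = u , ∧-true (Bool.not-injective p)

perp-subgroup : ∀ (U : Vec Bool n → Bool) → Subgroup (perp U)
perp-subgroup U = record
  { 0∈ = perp-intro U _ λ u _ → dot-0ʳ u
  ; ⊕∈ = λ {v} {w} v∈ w∈ → perp-intro U _ λ u u∈ →
      trans (dot-⊕ʳ u v w) (cong₂ _xor_ (perp-elim U v v∈ u u∈) (perp-elim U w w∈ u u∈))
  }

restrict-subgroup : ∀ {U : Vec Bool n → Bool} → Subgroup U → ∀ v → Subgroup (restrict U v)
restrict-subgroup {U = U} sg v = record
  { 0∈ = cong₂ _∧_ (0∈ sg) (cong not (dot-0ˡ v))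
  ; ⊕∈ = λ {u} {w} u∈ w∈ → let (a , b) = ∧-true u∈ ; (c , d) = ∧-true w∈ in
      cong₂ _∧_ (⊕∈ sg a c) (cong not (trans (dot-⊕ˡ u w v)
        (cong₂ _xor_ (Bool.not-injective b) (Bool.not-injective d))))
  }

-- Either `v` is orthogonal to `U` and nothing is lost, or exactly half of `U` survives. Writing
-- both cases as one formula lets them be summed over `v`; in the moment computation the indicator
-- tells whether `v` fails to impose a new condition on `U`.
size-restrict : ∀ {U : Vec Bool n → Bool} → Subgroup U → ∀ v →
  2 * size (restrict U v) ≡ size U * (1 + ⟦ perp U v ⟧)
size-restrict {n} {U} sg v with perp U v in eq
... | true  = trans (cong (2 *_) (∑-cong (cube n) λ u → cong ⟦_⟧ (go u))) (*-comm 2 (size U))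
  where
  go : ∀ u → restrict U v u ≡ U u
  go u with U u in u∈
  ... | false = refl
  ... | true  = cong not (perp-elim U v eq u u∈)
... | false with perp-witness U v eq
...   | u₀ , u₀∈ , u₀v = trans (half-size sg v u₀∈ u₀v) (sym (*-identityʳ _))

size-cube : ∀ n → length (cube n) ≡ 2 ^ n
size-cube n = length-vecs n 𝔽₂

∑-cube-const : ∀ n c → ∑ (cube n) (λ _ → c) ≡ 2 ^ n * c
∑-cube-const n c = trans (∑-const (cube n) c) (cong (_* c) (size-cube n))

∑-single : ∀ (u₀ : Vec Bool n) (f : Vec Bool n → Bool) → (∀ u → f u ≡ true → u ≡ u₀) →
  ∑ (cube n) (λ u → ⟦ f u ⟧) ≤ 1
∑-single []       f h = ≤-trans (≤-reflexive (+-identityʳ _)) (⟦⟧≤1 (f []))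
∑-single {suc n} (a ∷ u₀) f h = ≤-trans (≤-reflexive (∑-cube-suc n _)) (go a h)
  where
  tl : ∀ a b → (∀ u → f u ≡ true → u ≡ b ∷ u₀) → ∀ u → f (a ∷ u) ≡ true → u ≡ u₀
  tl a b h u p = proj₂ (∷-injective (h (a ∷ u) p))
  zero-sum : ∀ a → (∀ u → f (a ∷ u) ≢ true) → ∑ (cube n) (λ u → ⟦ f (a ∷ u) ⟧) ≡ 0
  zero-sum a h = trans (∑-cong (cube n) λ u → cong ⟦_⟧ (Bool.¬-not (h u))) (trans (∑-cube-const n 0) (*-zeroʳ (2 ^ n)))
  go : ∀ a → (∀ u → f u ≡ true → u ≡ a ∷ u₀) →
       ∑ (cube n) (λ u → ⟦ f (false ∷ u) ⟧) + ∑ (cube n) (λ u → ⟦ f (true ∷ u) ⟧) ≤ 1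
  go false h = +-mono-≤ {_} {1} {_} {0} (∑-single u₀ (f ∘ (false ∷_)) (tl false false h))
    (≤-reflexive (zero-sum true λ u p → case (∷-injective (h _ p))))
    where case : ∀ {P : Set} → true ≡ false × P → _
          case ()
  go true h = +-mono-≤ {_} {0} {_} {1}
    (≤-reflexive (zero-sum false λ u p → case (∷-injective (h _ p))))
    (∑-single u₀ (f ∘ (true ∷_)) (tl true true h))
    where case : ∀ {P : Set} → false ≡ true × P → _
          case ()

-- Count the orthogonal pairs (u , v) with u ∈ U in both orders.
size-perp : ∀ {U : Vec Bool n → Bool} → Subgroup U → size U * size (perp U) ≤ 2 ^ n
size-perp {n} {U} sg = +-cancelˡ-≤ (size U * 2 ^ n) _ _ (begin
  size U * 2 ^ n + size U * size (perp U)                 ≡⟨ *-distribˡ-+ (size U) _ _ ⟨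
  size U * (2 ^ n + size (perp U))                        ≡⟨ cong (λ z → size U * (z + size (perp U))) (trans (∑-cube-const n 1) (*-identityʳ _)) ⟨
  size U * (∑ c (λ _ → 1) + size (perp U))                ≡⟨ cong (size U *_) (∑-+ c _ _) ⟨
  size U * ∑ c (λ v → 1 + ⟦ perp U v ⟧)                   ≡⟨ ∑-*ˡ c (size U) _ ⟨
  ∑ c (λ v → size U * (1 + ⟦ perp U v ⟧))                 ≡⟨ ∑-cong c (λ v → size-restrict sg v) ⟨
  ∑ c (λ v → 2 * size (restrict U v))                     ≡⟨ ∑-*ˡ c 2 _ ⟩
  2 * ∑ c (λ v → size (restrict U v))                     ≡⟨ cong (2 *_) (∑-swap c c _) ⟩
  2 * ∑ c (λ u → ∑ c (λ v → ⟦ restrict U v u ⟧))          ≡⟨ cong (2 *_) (∑-cong c λ u → trans (∑-cong c λ v → by-u u v) (∑-*ˡ c ⟦ U u ⟧ _)) ⟩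
  2 * ∑ c (λ u → ⟦ U u ⟧ * size (restrict everything u))  ≡⟨ ∑-*ˡ c 2 _ ⟨
  ∑ c (λ u → 2 * (⟦ U u ⟧ * size (restrict everything u))) ≡⟨ ∑-cong c (λ u → rearrange ⟦ U u ⟧ _) ⟩
  ∑ c (λ u → ⟦ U u ⟧ * (2 * size (restrict everything u))) ≤⟨ ∑-mono c bound ⟩
  ∑ c (λ u → ⟦ U u ⟧ * 2 ^ n + ⟦ perp everything u ⟧ * 2 ^ n) ≡⟨ ∑-+ c _ _ ⟩
  ∑ c (λ u → ⟦ U u ⟧ * 2 ^ n) + ∑ c (λ u → ⟦ perp everything u ⟧ * 2 ^ n)
    ≡⟨ cong₂ _+_ (∑-*ʳ c (2 ^ n) _) (∑-*ʳ c (2 ^ n) _) ⟩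
  size U * 2 ^ n + size (perp everything) * 2 ^ n
    ≤⟨ +-monoʳ-≤ _ (*-monoˡ-≤ (2 ^ n) (∑-single 0⃗ (perp everything) only-zero)) ⟩
  size U * 2 ^ n + 1 * 2 ^ n                              ≡⟨ cong (size U * 2 ^ n +_) (*-identityˡ _) ⟩
  size U * 2 ^ n + 2 ^ n                                  ∎)
  where
  open ≤-Reasoning
  c = cube n
  everything : Vec Bool n → Bool
  everything _ = true
  everything-subgroup : Subgroup everything
  everything-subgroup = record { 0∈ = refl ; ⊕∈ = λ _ _ → refl }
  rearrange : ∀ a b → 2 * (a * b) ≡ a * (2 * b)
  rearrange = solve-∀
  by-u : ∀ u v → ⟦ restrict U v u ⟧ ≡ ⟦ U u ⟧ * ⟦ restrict everything u v ⟧
  by-u u v = trans (⟦⟧-∧ (U u) _) (cong (λ z → ⟦ U u ⟧ * ⟦ not z ⟧) (dot-comm u v))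
  only-zero : ∀ u → perp everything u ≡ true → u ≡ 0⃗
  only-zero u p = dot-nondegenerate u 0⃗ λ w →
    trans (dot-comm u w) (trans (perp-elim everything u p w refl) (sym (dot-0ˡ w)))
  lem : ∀ a b p → a ≤ 1 → a * (p * (1 + b)) ≤ a * p + b * p
  lem zero b p _ = z≤n
  lem (suc zero) b p _ = ≤-reflexive (go b p)
    where go : ∀ b p → 1 * (p * (1 + b)) ≡ 1 * p + b * p
          go = solve-∀
  lem (suc (suc a)) b p (s≤s ())
  bound : ∀ u → ⟦ U u ⟧ * (2 * size (restrict everything u)) ≤ ⟦ U u ⟧ * 2 ^ n + ⟦ perp everything u ⟧ * 2 ^ n
  bound u rewrite size-restrict everything-subgroup u | ∑-cube-const n 1 | *-identityʳ (2 ^ n) =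
    lem ⟦ U u ⟧ ⟦ perp everything u ⟧ (2 ^ n) (⟦⟧≤1 (U u))

-- Tensor products and contraction

infixr 7 _·_ _⊗_

_·_ : Bool → Vec Bool n → Vec Bool n
b · u = Vec.map (b ∧_) u

_⊗_ : Vec Bool k → Vec Bool n → Vec Bool (k * n)
[]      ⊗ w = []
(b ∷ x) ⊗ w = (b · w) Vec.++ (x ⊗ w)

true· : (u : Vec Bool n) → true · u ≡ u
true· []      = refl
true· (a ∷ u) = cong (a ∷_) (true· u)

false· : (u : Vec Bool n) → false · u ≡ 0⃗
false· []      = refl
false· (a ∷ u) = cong (false ∷_) (false· u)

dot-· : ∀ b (u v : Vec Bool n) → dot u (b · v) ≡ b ∧ dot u v
dot-· false u v = trans (cong (dot u) (false· v)) (dot-0ʳ u)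
dot-· true  u v = cong (dot u) (true· v)

·-⊕ : ∀ b (u v : Vec Bool n) → b · (u ⊕ v) ≡ b · u ⊕ b · v
·-⊕ b []      []      = refl
·-⊕ b (a ∷ u) (c ∷ v) = cong₂ _∷_ (Bool.∧-distribˡ-xor b a c) (·-⊕ b u v)

⊗-⊕ : ∀ (x : Vec Bool k) (u v : Vec Bool n) → x ⊗ (u ⊕ v) ≡ x ⊗ u ⊕ x ⊗ v
⊗-⊕ []      u v = refl
⊗-⊕ (b ∷ x) u v = trans (cong₂ Vec._++_ (·-⊕ b u v) (⊗-⊕ x u v))
  (sym (zipWith-++ _xor_ (b · u) (x ⊗ u) (b · v) (x ⊗ v)))

replicate-++ : ∀ m {n} (a : A) → replicate m a Vec.++ replicate n a ≡ replicate (m + n) a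
replicate-++ zero    a = refl
replicate-++ (suc m) a = cong (a ∷_) (replicate-++ m a)

⊗-0 : ∀ (x : Vec Bool k) → x ⊗ 0⃗ {n} ≡ 0⃗
⊗-0 []              = refl
⊗-0 {n = n} (b ∷ x) = trans (cong₂ Vec._++_ (lem b n) (⊗-0 x)) (replicate-++ n false)
  where
  lem : ∀ b n → b · 0⃗ {n} ≡ 0⃗
  lem b zero    = refl
  lem b (suc n) = cong₂ _∷_ (Bool.∧-zeroʳ b) (lem b n)

-- With `z` read as a k × n matrix stored by rows, this is the matrix-vector product z v.
contract : ∀ k → Vec Bool n → Vec Bool (k * n) → Vec Bool k
contract         zero    v z = []
contract {n = n} (suc k) v z = dot v (take n z) ∷ contract k v (drop n z)

contract-⊕ : ∀ k (v : Vec Bool n) y z → contract k v (y ⊕ z) ≡ contract k v y ⊕ contract k v z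
contract-⊕         zero    v y z = refl
contract-⊕ {n = n} (suc k) v y z = cong₂ _∷_
  (trans (cong (dot v) (take-zipWith _xor_ y z)) (dot-⊕ʳ v _ _))
  (trans (cong (contract k v) (drop-zipWith {m = n} _xor_ y z)) (contract-⊕ k v _ _))

contract-⊗ : ∀ (v : Vec Bool n) (x : Vec Bool k) w → contract k v (x ⊗ w) ≡ dot v w · x
contract-⊗         v []      w = refl
contract-⊗ {n = n} v (b ∷ x) w with ++-injective (take n ((b ∷ x) ⊗ w)) (b · w) (take++drop≡id n ((b ∷ x) ⊗ w))
... | t , d rewrite t | d =
  cong₂ _∷_ (trans (dot-· b v w) (Bool.∧-comm b _)) (contract-⊗ v x w)

contract-0 : ∀ k (v : Vec Bool n) → contract k v 0⃗ ≡ 0⃗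
contract-0 k v = begin
  contract k v 0⃗                                         ≡⟨ ⊕-cancelʳ _ (contract k v 0⃗) ⟨
  contract k v 0⃗ ⊕ contract k v 0⃗ ⊕ contract k v 0⃗       ≡⟨ cong (_⊕ contract k v 0⃗) (contract-⊕ k v 0⃗ 0⃗) ⟨
  contract k v (0⃗ ⊕ 0⃗) ⊕ contract k v 0⃗                  ≡⟨ cong (λ z → contract k v z ⊕ contract k v 0⃗) (⊕-self 0⃗) ⟩
  contract k v 0⃗ ⊕ contract k v 0⃗                        ≡⟨ ⊕-self _ ⟩
  0⃗                                                      ∎
  where open ≡-Reasoning

-- Spans, independence and tensors with independent left factors

-- Repetitions in the list are harmless: sums over it serve only as upper bounds, and its length is
-- always 2 to the number of generators.
span : List (Vec Bool k) → List (Vec Bool k)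
span []       = 0⃗ ∷ []
span (b ∷ bs) = span bs ++ map (b ⊕_) (span bs)

0∈span : ∀ (bs : List (Vec Bool k)) → 0⃗ ∈ span bs
0∈span []       = here refl
0∈span (b ∷ bs) = ∈-++⁺ˡ (0∈span bs)

span-cases : ∀ (b : Vec Bool k) bs {x} → x ∈ span (b ∷ bs) → ∃ λ β → ∃ λ y → y ∈ span bs × x ≡ β · b ⊕ y
span-cases b bs {x} x∈ with ∈-++⁻ (span bs) x∈
... | inj₁ p = false , x , p , sym (trans (cong (_⊕ x) (false· b)) (⊕-identityˡ x))
... | inj₂ p with ∈-map⁻ (b ⊕_) p
...   | y , y∈ , refl = true , y , y∈ , cong (_⊕ y) (sym (true· b))

span-∷ : ∀ (b : Vec Bool k) bs β {y} → y ∈ span bs → β · b ⊕ y ∈ span (b ∷ bs)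
span-∷ b bs false {y} y∈ = ∈-++⁺ˡ (subst (_∈ span bs) (sym (trans (cong (_⊕ y) (false· b)) (⊕-identityˡ y))) y∈)
span-∷ b bs true  {y} y∈ = ∈-++⁺ʳ (span bs) (subst (_∈ map (b ⊕_) (span bs)) (cong (_⊕ y) (sym (true· b))) (∈-map⁺ (b ⊕_) y∈))

⊕-interchange : (s t u v : Vec Bool n) → (s ⊕ t) ⊕ (u ⊕ v) ≡ (s ⊕ u) ⊕ (t ⊕ v)
⊕-interchange []      []      []      []      = refl
⊕-interchange (a ∷ s) (b ∷ t) (c ∷ u) (d ∷ v) = cong₂ _∷_ (xor-interchange a b c d) (⊕-interchange s t u v)

xor-· : ∀ a b (u : Vec Bool n) → a · u ⊕ b · u ≡ (a xor b) · u
xor-· a b []      = refl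
xor-· a b (c ∷ u) = cong₂ _∷_ (sym (Bool.∧-distribʳ-xor c a b)) (xor-· a b u)

span-⊕ : ∀ (bs : List (Vec Bool k)) {x y} → x ∈ span bs → y ∈ span bs → x ⊕ y ∈ span bs
span-⊕ []       (here refl) (here refl) = here (⊕-self 0⃗)
span-⊕ (b ∷ bs) x∈ y∈ with span-cases b bs x∈ | span-cases b bs y∈
... | β , x , x∈′ , refl | γ , y , y∈′ , refl =
  subst (_∈ span (b ∷ bs)) (trans (cong (_⊕ (x ⊕ y)) (sym (xor-· β γ b))) (⊕-interchange (β · b) (γ · b) x y))
    (span-∷ b bs (β xor γ) (span-⊕ bs x∈′ y∈′))

data Independent {k} : List (Vec Bool k) → Set where
  []  : Independent []
  _∷_ : ∀ {b bs} → b ∉ span bs → Independent bs → Independent (b ∷ bs)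

combination : (bs : List (Vec Bool k)) → Vec (Vec Bool n) (length bs) → Vec Bool (k * n)
combination []       []       = 0⃗
combination (b ∷ bs) (w ∷ ws) = b ⊗ w ⊕ combination bs ws

contract-combination : ∀ (v : Vec Bool n) (bs : List (Vec Bool k)) ws → contract k v (combination bs ws) ∈ span bs
contract-combination {k = k} v [] [] = here (contract-0 k v)
contract-combination {k = k} v (b ∷ bs) (w ∷ ws) =
  subst (_∈ span (b ∷ bs)) (sym (trans (contract-⊕ k v (b ⊗ w) _) (cong (_⊕ _) (contract-⊗ v b w))))
    (span-∷ b bs (dot v w) (contract-combination v bs ws))

-- If the coefficients differed, adding the two sides would give b = x ⊕ y, which lies in the span.
coefficient-unique : ∀ {b : Vec Bool k} bs → b ∉ span bs → ∀ {β γ x y} → x ∈ span bs → y ∈ span bs →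
  β · b ⊕ x ≡ γ · b ⊕ y → β ≡ γ
coefficient-unique {b = b} bs b∉ {β} {γ} {x} {y} x∈ y∈ eq with β Bool.≟ γ
... | yes p = p
... | no  p = contradiction (subst (_∈ span bs) (sym b≡) (span-⊕ bs x∈ y∈)) b∉
  where
  open ≡-Reasoning
  xor-≢ : ∀ {a b} → a ≢ b → a xor b ≡ true
  xor-≢ {false} {false} h = contradiction refl h
  xor-≢ {false} {true}  h = refl
  xor-≢ {true}  {false} h = refl
  xor-≢ {true}  {true}  h = contradiction refl h
  b≡ : b ≡ x ⊕ y
  b≡ = begin
    b                                      ≡⟨ ⊕-cancelʳ b (x ⊕ y) ⟨
    b ⊕ (x ⊕ y) ⊕ (x ⊕ y)                  ≡⟨ cong (λ z → z ⊕ (x ⊕ y) ⊕ (x ⊕ y)) (trans (sym (true· b)) (trans (cong (_· b) (sym (xor-≢ p))) (sym (xor-· β γ b)))) ⟩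
    β · b ⊕ γ · b ⊕ (x ⊕ y) ⊕ (x ⊕ y)      ≡⟨ cong (_⊕ (x ⊕ y)) (⊕-interchange (β · b) _ x y) ⟩
    (β · b ⊕ x) ⊕ (γ · b ⊕ y) ⊕ (x ⊕ y)    ≡⟨ cong (λ z → z ⊕ (γ · b ⊕ y) ⊕ (x ⊕ y)) eq ⟩
    (γ · b ⊕ y) ⊕ (γ · b ⊕ y) ⊕ (x ⊕ y)    ≡⟨ cong (_⊕ (x ⊕ y)) (⊕-self _) ⟩
    0⃗ ⊕ (x ⊕ y)                            ≡⟨ ⊕-identityˡ _ ⟩
    x ⊕ y                                  ∎

⊕-injectiveʳ : ∀ (u : Vec Bool n) {v w} → u ⊕ v ≡ u ⊕ w → v ≡ w
⊕-injectiveʳ u {v} {w} eq = trans (sym (lem v)) (trans (cong (u ⊕_) eq) (lem w))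
  where
  lem : ∀ v → u ⊕ (u ⊕ v) ≡ v
  lem v = trans (sym (⊕-assoc u u v)) (trans (cong (_⊕ v) (⊕-self u)) (⊕-identityˡ v))

-- Contracting with an arbitrary `v` leaves a combination of the vectors of `bs` with coefficients
-- dot v w. Independence identifies the leading coefficients, and since `v` is arbitrary, the
-- leading vectors agree.
combination-injective : ∀ {bs : List (Vec Bool k)} → Independent bs →
  ∀ {ws ws′ : Vec (Vec Bool n) (length bs)} → combination bs ws ≡ combination bs ws′ → ws ≡ ws′
combination-injective [] {[]} {[]} _ = refl
combination-injective {k = k} {bs = b ∷ bs} (b∉ ∷ ind) {w ∷ ws} {w′ ∷ ws′} eq = cong₂ _∷_ w≡
  (combination-injective ind (⊕-injectiveʳ (b ⊗ w) (trans eq (cong (λ z → b ⊗ z ⊕ combination bs ws′) (sym w≡)))))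
  where
  expand : ∀ v w ws → dot v w · b ⊕ contract k v (combination bs ws) ≡ contract k v (combination (b ∷ bs) (w ∷ ws))
  expand v w ws = sym (trans (contract-⊕ k v (b ⊗ w) _) (cong (_⊕ _) (contract-⊗ v b w)))
  w≡ : w ≡ w′
  w≡ = dot-nondegenerate w w′ λ v → trans (dot-comm w v) (trans
    (coefficient-unique bs b∉ (contract-combination v bs ws) (contract-combination v bs ws′)
      (trans (expand v w ws) (trans (cong (contract k v) eq) (sym (expand v w′ ws′)))))
    (dot-comm v w′))

∑-⊆ : ∀ {xs ys : List A} (f : A → ℕ) → Unique xs → (∀ {x} → x ∈ xs → x ∈ ys) → ∑ xs f ≤ ∑ ys f
∑-⊆ {xs = []} _ _ _ = z≤n
∑-⊆ {xs = x ∷ xs} f (x∉ ∷ uniq) sub with ∈-∃++ (sub (here refl))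
... | as , bs , refl = begin
  f x + ∑ xs f               ≤⟨ +-monoʳ-≤ (f x) (∑-⊆ f uniq sub′) ⟩
  f x + ∑ (as ++ bs) f       ≡⟨ cong (f x +_) (∑-++ as bs f) ⟩
  f x + (∑ as f + ∑ bs f)    ≡⟨ ℕ+.x∙yz≈y∙xz (f x) (∑ as f) _ ⟩
  ∑ as f + (f x + ∑ bs f)    ≡⟨ ∑-++ as (x ∷ bs) f ⟨
  ∑ (as ++ x ∷ bs) f         ∎
  where
  open ≤-Reasoning
  sub′ : ∀ {z} → z ∈ xs → z ∈ as ++ bs
  sub′ z∈ with ∈-++⁻ as (sub (there z∈))
  ... | inj₁ p         = ∈-++⁺ˡ p
  ... | inj₂ (here eq) = contradiction (sym eq) (All.lookup x∉ z∈)
  ... | inj₂ (there p) = ∈-++⁺ʳ as p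

unique-length : ∀ {xs ys : List A} → Unique xs → (∀ {x} → x ∈ xs → x ∈ ys) → length xs ≤ length ys
unique-length {xs = xs} {ys} uniq sub = subst₂ _≤_
  (trans (∑-const xs 1) (*-identityʳ _)) (trans (∑-const ys 1) (*-identityʳ _)) (∑-⊆ (λ _ → 1) uniq sub)

members : (Vec Bool n → Bool) → List (Vec Bool n)
members {n} V = filter (λ v → V v Bool.≟ true) (cube n)

length-members : ∀ (V : Vec Bool n → Bool) → length (members V) ≡ size V
length-members {n} V = go (cube n)
  where
  go : ∀ xs → length (filter (λ v → V v Bool.≟ true) xs) ≡ ∑ xs (λ v → ⟦ V v ⟧)
  go [] = refl
  go (x ∷ xs) with V x
  ... | true  = cong suc (go xs)
  ... | false = go xs

-- Slices of a subgroup and the sum of their dimensions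

slice : (Vec Bool (k * n) → Bool) → Vec Bool k → Vec Bool n → Bool
slice V x w = V (x ⊗ w)

slice-subgroup : ∀ {V : Vec Bool (k * n) → Bool} → Subgroup V → ∀ x → Subgroup (slice {k} {n} V x)
slice-subgroup {V = V} sg x = record
  { 0∈ = trans (cong V (⊗-0 x)) (0∈ sg)
  ; ⊕∈ = λ {u} {v} u∈ v∈ → trans (cong V (⊗-⊕ x u v)) (⊕∈ sg u∈ v∈)
  }

coefficients : (Vec Bool (k * n) → Bool) → (bs : List (Vec Bool k)) → List (Vec (Vec Bool n) (length bs))
coefficients V []       = [] ∷ []
coefficients {k} {n} V (b ∷ bs) = cartesianProductWith _∷_ (members (slice {k} {n} V b)) (coefficients {k} {n} V bs)

∏ : List A → (A → ℕ) → ℕ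
∏ []       f = 1
∏ (x ∷ xs) f = f x * ∏ xs f

module _ {V : Vec Bool (k * n) → Bool} (sg : Subgroup V) where

  length-coefficients : ∀ bs → length (coefficients {k} {n} V bs) ≡ ∏ bs (λ b → size (slice {k} {n} V b))
  length-coefficients []       = refl
  length-coefficients (b ∷ bs) = trans (length-cartesianProductWith _∷_ (members (slice {k} {n} V b)) _)
    (cong₂ _*_ (length-members (slice {k} {n} V b)) (length-coefficients bs))

  coefficients-unique : ∀ bs → Unique (coefficients {k} {n} V bs)
  coefficients-unique []       = [] ∷ []
  coefficients-unique (b ∷ bs) = Unique.cartesianProductWith⁺ _∷_ ∷-injective
    (Unique.filter⁺ _ (cube-unique n)) (coefficients-unique bs)

  combination-∈ : ∀ bs {ws} → ws ∈ coefficients {k} {n} V bs → V (combination bs ws) ≡ true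
  combination-∈ [] (here refl) = 0∈ sg
  combination-∈ (b ∷ bs) p with ∈-cartesianProductWith⁻ _∷_ (members (slice {k} {n} V b)) (coefficients {k} {n} V bs) p
  ... | w , ws , w∈ , ws∈ , refl =
    ⊕∈ sg (proj₂ (∈-filter⁻ (λ v → V (b ⊗ v) Bool.≟ true) {xs = cube n} w∈)) (combination-∈ bs ws∈)

  -- Choosing one w from each slice and forming the sum of all b ⊗ w is an injection from the
  -- product of the slices into `V`.
  ∏-size-slice : ∀ {bs} → Independent bs → ∏ bs (λ b → size (slice {k} {n} V b)) ≤ size V
  ∏-size-slice {bs} ind = begin
    ∏ bs (λ b → size (slice {k} {n} V b))                          ≡⟨ length-coefficients bs ⟨
    length (coefficients {k} {n} V bs)                             ≡⟨ length-map (combination bs) (coefficients {k} {n} V bs) ⟨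
    length (map (combination bs) (coefficients {k} {n} V bs))      ≤⟨ unique-length (Unique.map⁺ (combination-injective ind) (coefficients-unique bs)) sub ⟩
    length (members V)                                             ≡⟨ length-members V ⟩
    size V                                                         ∎
    where
    open ≤-Reasoning
    sub : ∀ {v} → v ∈ map (combination bs) (coefficients {k} {n} V bs) → v ∈ members V
    sub p with ∈-map⁻ (combination bs) p
    ... | ws , ws∈ , refl = ∈-filter⁺ _ (∈-cube _) (combination-∈ bs ws∈)

-- The dimension bound is the case n = 1 of `∏-size-slice` with `V` the whole space: every slice is
-- 𝔽₂, of size 2, so no exchange argument is required.
independent-length : ∀ {bs : List (Vec Bool k)} → Independent bs → length bs ≤ k
independent-length {k} {bs} ind = 2^-reflects-≤ (begin
  2 ^ length bs                                     ≡⟨ two bs ⟨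
  ∏ bs (λ b → size (slice {k} {1} everything b))    ≤⟨ ∏-size-slice {k} {1} {everything} (record { 0∈ = refl ; ⊕∈ = λ _ _ → refl }) ind ⟩
  size everything                                   ≡⟨ trans (∑-cube-const (k * 1) 1) (*-identityʳ _) ⟩
  2 ^ (k * 1)                                       ≡⟨ cong (2 ^_) (*-identityʳ k) ⟩
  2 ^ k                                             ∎)
  where
  open ≤-Reasoning
  everything : Vec Bool (k * 1) → Bool
  everything _ = true
  two : ∀ bs → ∏ bs (λ b → size (slice {k} {1} everything b)) ≡ 2 ^ length bs
  two []       = refl
  two (b ∷ bs) = cong (2 *_) (two bs)
  2^-reflects-≤ : ∀ {a b} → 2 ^ a ≤ 2 ^ b → a ≤ b
  2^-reflects-≤ {a} {b} p = subst₂ _≤_ (⌊log₂[2^n]⌋≡n a) (⌊log₂[2^n]⌋≡n b) (⌊log₂⌋-mono-≤ p)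

_∈?_ : ∀ (x : Vec Bool k) xs → Dec (x ∈ xs)
x ∈? xs = any? (Vec.≡-dec Bool._≟_ x) xs

2^⌊log₂n⌋≤n : ∀ n → 1 ≤ n → 2 ^ ⌊log₂ n ⌋ ≤ n
2^⌊log₂n⌋≤n = <-rec _ go
  where
  open ≤-Reasoning
  go : ∀ n → (∀ {m} → m < n → 1 ≤ m → 2 ^ ⌊log₂ m ⌋ ≤ m) → 1 ≤ n → 2 ^ ⌊log₂ n ⌋ ≤ n
  go (suc zero)        rec _ = ≤-refl
  go n@(suc (suc n′)) rec _ = begin
    2 ^ ⌊log₂ n ⌋                   ≡⟨ cong (2 ^_) (m+[n∸m]≡n {1} (⌊log₂⌋-mono-≤ {2} {n} (s≤s (s≤s z≤n)))) ⟨
    2 * 2 ^ (⌊log₂ n ⌋ ∸ 1)         ≡⟨ cong (λ z → 2 * 2 ^ z) (⌊log₂⌊n/2⌋⌋≡⌊log₂n⌋∸1 n) ⟨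
    2 * 2 ^ ⌊log₂ ⌊ n /2⌋ ⌋         ≤⟨ *-monoʳ-≤ 2 (rec (⌊n/2⌋<n (suc n′)) (s≤s z≤n)) ⟩
    2 * ⌊ n /2⌋                     ≡⟨ cong (⌊ n /2⌋ +_) (+-identityʳ _) ⟩
    ⌊ n /2⌋ + ⌊ n /2⌋               ≤⟨ +-monoʳ-≤ ⌊ n /2⌋ (⌊n/2⌋≤⌈n/2⌉ n) ⟩
    ⌊ n /2⌋ + ⌈ n /2⌉               ≡⟨ ⌊n/2⌋+⌈n/2⌉≡n n ⟩
    n                               ∎

-- The size of a subgroup is a power of two, but this is never proved. Rounding down suffices, since
-- the argument uses only 2 ^ `rank` ≤ `size`, monotonicity, and the values at powers of two.
rank : (Vec Bool n → Bool) → ℕ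
rank V = ⌊log₂ size V ⌋

2^≤⇒≤log : ∀ {a n} → 2 ^ a ≤ n → a ≤ ⌊log₂ n ⌋
2^≤⇒≤log {a} p = subst (_≤ _) (⌊log₂[2^n]⌋≡n a) (⌊log₂⌋-mono-≤ p)

∑-≥ : ∀ {xs : List A} {x} (f : A → ℕ) → x ∈ xs → f x ≤ ∑ xs f
∑-≥ f (here refl) = m≤m+n _ _
∑-≥ f (there p)   = ≤-trans (∑-≥ f p) (m≤n+m _ _)

1≤size : ∀ {V : Vec Bool n → Bool} → Subgroup V → 1 ≤ size V
1≤size {V = V} sg = ≤-trans (≤-reflexive (sym (cong ⟦_⟧ (0∈ sg)))) (∑-≥ (λ v → ⟦ V v ⟧) (∈-cube 0⃗))

∑-rank-slice : ∀ {V : Vec Bool (k * n) → Bool} → Subgroup V → ∀ {bs} → Independent bs →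
  ∑ bs (λ b → rank (slice {k} {n} V b)) ≤ rank V
∑-rank-slice {k} {n} {V} sg {bs} ind = 2^≤⇒≤log (≤-trans (go bs) (∏-size-slice {k} {n} sg ind))
  where
  go : ∀ bs → 2 ^ ∑ bs (λ b → rank (slice {k} {n} V b)) ≤ ∏ bs (λ b → size (slice {k} {n} V b))
  go []       = ≤-refl
  go (b ∷ bs) = ≤-trans (≤-reflexive (^-distribˡ-+-* 2 (rank (slice {k} {n} V b)) _))
    (*-mono-≤ (2^⌊log₂n⌋≤n _ (1≤size (slice-subgroup {k} {n} sg b))) (go bs))

-- Greedy bases

-- The newest vector comes first. Maximality is over everything outside the span of the older
-- vectors, so it makes `s` decrease along the construction and also bounds `s` on the half that `b`
-- adds to the span.
data Greedy {k} (s : Vec Bool k → ℕ) : List (Vec Bool k) → Set where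
  []   : Greedy s []
  step : ∀ {b bs} → b ∉ span bs → (∀ {x} → x ∉ span bs → s x ≤ s b) → Greedy s bs → Greedy s (b ∷ bs)

greedy⇒independent : ∀ {s : Vec Bool k → ℕ} {bs} → Greedy s bs → Independent bs
greedy⇒independent []             = []
greedy⇒independent (step b∉ _ gr) = b∉ ∷ greedy⇒independent gr

greedy-extend : ∀ {s : Vec Bool k → ℕ} {bs} → Greedy s bs →
  (∃ λ b → Greedy s (b ∷ bs)) ⊎ (∀ x → x ∈ span bs)
greedy-extend {k} {s} {bs} gr with filter (λ x → ¬? (x ∈? span bs)) (cube k) in eq
... | [] = inj₂ λ x → all-in x
  where
  all-in : ∀ x → x ∈ span bs
  all-in x with x ∈? span bs
  ... | yes p = p
  ... | no  p with subst (x ∈_) eq (∈-filter⁺ (λ x → ¬? (x ∈? span bs)) (∈-cube x) p)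
  ...   | ()
... | c ∷ cs = inj₁ (argmax s c cs , step outside maximal gr)
  where
  outside-all : ∀ {x} → x ∈ c ∷ cs → x ∉ span bs
  outside-all p = proj₂ (∈-filter⁻ (λ x → ¬? (x ∈? span bs)) {xs = cube k} (subst (_ ∈_) (sym eq) p))
  outside : argmax s c cs ∉ span bs
  outside = argmax-all s (outside-all (here refl)) (All.tabulate λ p → outside-all (there p))
  maximal : ∀ {x} → x ∉ span bs → s x ≤ s (argmax s c cs)
  maximal {x} x∉ with subst (x ∈_) eq (∈-filter⁺ (λ x → ¬? (x ∈? span bs)) (∈-cube x) x∉)
  ... | here refl = f[⊥]≤f[argmax] {f = s} c cs
  ... | there p   = All.lookup (f[xs]≤f[argmax] {f = s} c cs) p

greedy-basis : ∀ (s : Vec Bool k → ℕ) → ∃ λ bs → Greedy s bs × (∀ x → x ∈ span bs)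
-- An independent list has length at most `k`, so round k + 1 cannot produce another vector and the
-- search must have ended.
greedy-basis {k} s with go (suc k)
  where
  go : ∀ n → (∃ λ bs → Greedy s bs × length bs ≡ n) ⊎ (∃ λ bs → Greedy s bs × (∀ x → x ∈ span bs))
  go zero = inj₁ ([] , [] , refl)
  go (suc n) with go n
  ... | inj₂ done = inj₂ done
  ... | inj₁ (bs , gr , len) with greedy-extend gr
  ...   | inj₁ (b , gr′)  = inj₁ (b ∷ bs , gr′ , cong suc len)
  ...   | inj₂ spanning   = inj₂ (bs , gr , spanning)
... | inj₂ done = done
... | inj₁ (bs , gr , len) =
  contradiction (≤-trans (≤-reflexive (sym len)) (independent-length (greedy⇒independent gr))) 1+n≰n

-- Convexity and summation along a greedy basis

-- Convexity of the power: its increment over a step of length `d` grows with the starting point.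
^-superadditive : ∀ m d {x y} → x ≤ y → (d + x) ^ m + y ^ m ≤ (d + y) ^ m + x ^ m
^-superadditive zero    d x≤y = ≤-refl
^-superadditive (suc m) d {x} {y} x≤y
  with x ^ m | y ^ m | (d + x) ^ m | (d + y) ^ m
     | ^-monoˡ-≤ m x≤y | ^-monoˡ-≤ m (m≤n+m x d) | ^-superadditive m d x≤y
... | X | Y | X′ | Y′ | X≤Y | X≤X′ | ih with m≤n⇒∃[o]m+o≡n X≤X′
-- `P` is the increment (d + x)^m - x^m, and x * Y is added to both sides, so that the induction
-- hypothesis applies without subtraction. The remaining cross terms are a rearrangement inequality.
...   | P , refl = +-cancelʳ-≤ (x * Y) _ _ (begin
  (d + x) * (X + P) + y * Y + x * Y              ≡⟨ l₁ d x y X P Y ⟩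
  d * (X + P) + x * (X + P + Y) + y * Y          ≤⟨ +-monoˡ-≤ (y * Y) (+-mono-≤ (*-monoʳ-≤ d X′≤Y′) (*-monoʳ-≤ x ih)) ⟩
  d * Y′ + x * (Y′ + X) + y * Y                  ≡⟨ l₂ d x y X Y Y′ ⟩
  d * Y′ + x * X + (x * Y′ + y * Y)              ≤⟨ +-monoʳ-≤ (d * Y′ + x * X) (cross x≤y Y≤Y′) ⟩
  d * Y′ + x * X + (y * Y′ + x * Y)              ≡⟨ l₃ d x y X Y Y′ ⟩
  (d + y) * Y′ + x * X + x * Y                   ∎)
  where
  open ≤-Reasoning
  X′≤Y′ : X + P ≤ Y′
  X′≤Y′ = +-cancelʳ-≤ Y _ _ (≤-trans ih (+-monoʳ-≤ Y′ X≤Y))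
  Y≤Y′ : Y ≤ Y′
  Y≤Y′ = +-cancelˡ-≤ X _ _ (≤-trans (+-monoˡ-≤ Y (m≤m+n X P)) (≤-trans ih (≤-reflexive (+-comm Y′ X))))
  cross : ∀ {x y a b} → x ≤ y → a ≤ b → x * b + y * a ≤ y * b + x * a
  cross {x} {_} {a} x≤y a≤b with m≤n⇒∃[o]m+o≡n x≤y | m≤n⇒∃[o]m+o≡n a≤b
  ... | e , refl | f , refl = ≤-trans (m≤m+n _ (e * f)) (≤-reflexive (eq x e a f))
    where
    eq : ∀ x e a f → x * (a + f) + (x + e) * a + e * f ≡ (x + e) * (a + f) + x * a
    eq = solve-∀
  l₁ : ∀ d x y X P Y → (d + x) * (X + P) + y * Y + x * Y ≡ d * (X + P) + x * (X + P + Y) + y * Y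
  l₁ = solve-∀
  l₂ : ∀ d x y X Y Y′ → d * Y′ + x * (Y′ + X) + y * Y ≡ d * Y′ + x * X + (x * Y′ + y * Y)
  l₂ = solve-∀
  l₃ : ∀ d x y X Y Y′ → d * Y′ + x * X + (y * Y′ + x * Y) ≡ (d + y) * Y′ + x * X + x * Y
  l₃ = solve-∀

*-distrib-^ : ∀ a b m → (a * b) ^ m ≡ a ^ m * b ^ m
*-distrib-^ a b zero    = refl
*-distrib-^ a b (suc m) = trans (cong (a * b *_) (*-distrib-^ a b m)) (eq a b (a ^ m) (b ^ m))
  where
  eq : ∀ a b x y → a * b * (x * y) ≡ a * x * (b * y)
  eq = solve-∀

-- In the application `c` is 2^k, `κ` is k^m and `s` is x ↦ dim V_x; the hypothesis then reads
-- 2^(a-k) ≤ (a / k)^m.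
module _ {k} (s : Vec Bool k → ℕ) (m a₀ c κ : ℕ) (κ2^a≤ca^m : ∀ a → a₀ ≤ a → a ≤ k → κ * 2 ^ a ≤ c * a ^ m) where

  span-length : ∀ (bs : List (Vec Bool k)) → length (span bs) ≡ 2 ^ length bs
  span-length []       = refl
  span-length (b ∷ bs) = trans (length-++ (span bs)) (cong₂ _+_ (span-length bs)
    (trans (length-map (b ⊕_) (span bs)) (trans (span-length bs) (sym (+-identityʳ _)))))

  ∑-lower : ∀ (bs : List (Vec Bool k)) {u} → (∀ {b} → b ∈ bs → u ≤ s b) → length bs * u ≤ ∑ bs s
  ∑-lower []       h = z≤n
  ∑-lower (b ∷ bs) h = +-mono-≤ (h (here refl)) (∑-lower bs (h ∘ there))

  -- With Q = Σ_{a₀ < j ≤ ℓ} 2^(j-1) s(bⱼ)^m, this is Abel summation in progress: u stands for the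
  -- next, smaller value of s, and u = 0 gives the bound on Q.
  Balanced : List (Vec Bool k) → ℕ → Set
  Balanced bs Q = ∀ u → (∀ {b} → b ∈ bs → u ≤ s b) →
    κ * Q + c * (length bs * u) ^ m ≤ c * (∑ bs s) ^ m + κ * 2 ^ length bs * u ^ m

  balanced-0 : ∀ bs → Balanced bs 0
  balanced-0 bs u h = ≤-trans (≤-reflexive (cong (_+ c * (length bs * u) ^ m) (*-zeroʳ κ)))
    (≤-trans (*-monoʳ-≤ c (^-monoˡ-≤ m (∑-lower bs h))) (m≤m+n _ _))

  -- The claim is first shown at u = s b. There the previous balance applies, because `s b` is below
  -- all earlier values, and convexity absorbs the new summand of the sum. Lowering u afterwards
  -- keeps the inequality: the coefficient of u^m on the left, c (ℓ+1)^m, is at least the one on the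
  -- right, κ 2^(ℓ+1).
  balanced-step : ∀ {b bs Q} → a₀ ≤ length bs → Greedy s (b ∷ bs) → Balanced bs Q →
    Balanced (b ∷ bs) (Q + 2 ^ length bs * s b ^ m)
  balanced-step {b} {bs} {Q} a₀≤ gr@(step b∉ maxi gr′) bal u u≤ =
    subst (λ z → κ * (Q + p * S) + z ≤ c * T′ + κ * 2 ^ suc ℓ * u ^ m) (split u)
      (descend (^-monoˡ-≤ m (u≤ (here refl)))
        (κ2^a≤ca^m (suc ℓ) (m≤n⇒m≤1+n a₀≤) (independent-length (greedy⇒independent gr)))
        (subst (λ z → κ * (Q + p * S) + z ≤ c * T′ + κ * 2 ^ suc ℓ * S) (sym (split (s b))) at-s))
    where
    ℓ  = length bs
    p  = 2 ^ ℓ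
    S  = s b ^ m
    T  = (∑ bs s) ^ m
    T′ = (s b + ∑ bs s) ^ m
    sorted : ∀ {bs} → Greedy s bs → b ∉ span bs → ∀ {b′} → b′ ∈ bs → s b ≤ s b′
    sorted (step _ mx g) b∉ (here refl) = mx (b∉ ∘ ∈-++⁺ˡ)
    sorted (step _ mx g) b∉ (there q)   = sorted g (b∉ ∘ ∈-++⁺ˡ) q
    at-s : κ * (Q + p * S) + c * (suc ℓ * s b) ^ m ≤ c * T′ + κ * 2 ^ suc ℓ * S
    at-s = add-up (bal (s b) (sorted gr′ b∉)) (^-superadditive m (s b) (∑-lower bs (sorted gr′ b∉)))
      where
      open ≤-Reasoning
      add-up : ∀ {Y Z} → κ * Q + c * Y ≤ c * T + κ * p * S → Z + T ≤ T′ + Y →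
                κ * (Q + p * S) + c * Z ≤ c * T′ + κ * 2 ^ suc ℓ * S
      add-up {Y} {Z} h₁ h₂ = +-cancelʳ-≤ (c * Y + c * T) _ _ (begin
        κ * (Q + p * S) + c * Z + (c * Y + c * T)            ≡⟨ e₁ κ Q p S c Z Y T ⟩
        (κ * Q + c * Y) + c * (Z + T) + κ * p * S            ≤⟨ +-monoˡ-≤ _ (+-mono-≤ h₁ (*-monoʳ-≤ c h₂)) ⟩
        (c * T + κ * p * S) + c * (T′ + Y) + κ * p * S       ≡⟨ e₂ κ p S c Y T T′ ⟩
        c * T′ + κ * (2 * p) * S + (c * Y + c * T)           ∎)
        where
        e₁ : ∀ κ Q p S c Z Y T → κ * (Q + p * S) + c * Z + (c * Y + c * T) ≡ (κ * Q + c * Y) + c * (Z + T) + κ * p * S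
        e₁ = solve-∀
        e₂ : ∀ κ p S c Y T T′ → (c * T + κ * p * S) + c * (T′ + Y) + κ * p * S ≡ c * T′ + κ * (2 * p) * S + (c * Y + c * T)
        e₂ = solve-∀
    split : ∀ v → c * suc ℓ ^ m * v ^ m ≡ c * (suc ℓ * v) ^ m
    split v = trans (*-assoc c _ _) (cong (c *_) (sym (*-distrib-^ (suc ℓ) v m)))
    descend : ∀ {X Y K C v w} → v ≤ w → K ≤ C → X + C * w ≤ Y + K * w → X + C * v ≤ Y + K * v
    descend {X} {Y} {K} {C} {v} v≤w K≤C h with m≤n⇒∃[o]m+o≡n v≤w
    ... | e , refl = +-cancelʳ-≤ (C * e) _ _ (begin
      X + C * v + C * e     ≡⟨ +-assoc X _ _ ⟩
      X + (C * v + C * e)   ≡⟨ cong (X +_) (*-distribˡ-+ C v e) ⟨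
      X + C * (v + e)       ≤⟨ h ⟩
      Y + K * (v + e)       ≡⟨ cong (Y +_) (*-distribˡ-+ K v e) ⟩
      Y + (K * v + K * e)   ≡⟨ +-assoc Y _ _ ⟨
      Y + K * v + K * e     ≤⟨ +-monoʳ-≤ (Y + K * v) (*-monoˡ-≤ e K≤C) ⟩
      Y + K * v + C * e     ∎)
      where open ≤-Reasoning

  -- `g x` will be the scaled number of rank-one tensors in the slice at x: `A` is the trivial
  -- bound, and B + E s(x)^m the bound for one factor fewer.
  module _ (g : Vec Bool k → ℕ) (A B E r : ℕ) (g≤A : ∀ x → g x ≤ A) (g≤ : ∀ x → g x ≤ B + E * s x ^ m)
           (∑s≤r : ∀ {bs} → Independent bs → ∑ bs s ≤ r) where

    ∑-span-≤A : ∀ bs → ∑ (span bs) g ≤ 2 ^ length bs * A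
    ∑-span-≤A bs = ≤-trans (∑-mono (span bs) g≤A)
      (≤-reflexive (trans (∑-const (span bs) A) (cong (_* A) (span-length bs))))

    -- Each new `b` doubles the span, and the new half b ⊕ span bs lies outside span bs, where `s`
    -- is at most `s b`. The innermost 2^a₀ terms get only the trivial bound `A`.
    ∑-span : ∀ {bs} → Greedy s bs → a₀ ≤ length bs → ∃ λ Q → Balanced bs Q ×
      ∑ (span bs) g ≤ 2 ^ a₀ * A + 2 ^ length bs * B + E * Q
    ∑-span {bs} gr a₀≤ with m≤n⇒m<n∨m≡n a₀≤
    ∑-span {bs} gr a₀≤ | inj₂ refl = 0 , balanced-0 bs , ≤-trans (∑-span-≤A bs) (≤-trans (m≤m+n _ _) (m≤m+n _ _))
    ∑-span {b ∷ bs} gr@(step b∉ maxi gr′) _ | inj₁ (s≤s a₀≤) with ∑-span gr′ a₀≤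
    ... | Q , bal , h = Q + 2 ^ length bs * s b ^ m , balanced-step a₀≤ gr bal , (begin
      ∑ (span bs ++ map (b ⊕_) (span bs)) g                ≡⟨ ∑-++ (span bs) _ g ⟩
      ∑ (span bs) g + ∑ (map (b ⊕_) (span bs)) g           ≡⟨ cong (∑ (span bs) g +_) (∑-map (b ⊕_) (span bs) g) ⟩
      ∑ (span bs) g + ∑ (span bs) (λ y → g (b ⊕ y))        ≤⟨ +-mono-≤ h (∑-mono-∈ (span bs) outer) ⟩
      2 ^ a₀ * A + p * B + E * Q + ∑ (span bs) (λ _ → B + E * s b ^ m)
        ≡⟨ cong (2 ^ a₀ * A + p * B + E * Q +_) (trans (∑-const (span bs) _) (cong (_* _) (span-length bs))) ⟩
      2 ^ a₀ * A + p * B + E * Q + p * (B + E * s b ^ m)   ≡⟨ eq (2 ^ a₀ * A) p B E Q (s b ^ m) ⟩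
      2 ^ a₀ * A + 2 * p * B + E * (Q + p * s b ^ m)       ∎)
      where
      open ≤-Reasoning
      p = 2 ^ length bs
      eq : ∀ a p B E Q S → a + p * B + E * Q + p * (B + E * S) ≡ a + 2 * p * B + E * (Q + p * S)
      eq = solve-∀
      outer : ∀ {y} → y ∈ span bs → g (b ⊕ y) ≤ B + E * s b ^ m
      outer {y} y∈ = ≤-trans (g≤ (b ⊕ y)) (+-monoʳ-≤ B (*-monoʳ-≤ E (^-monoˡ-≤ m (maxi λ b⊕y∈ →
        b∉ (subst (_∈ span bs) (⊕-cancelʳ b y) (span-⊕ bs b⊕y∈ y∈))))))

    ∑-greedy : κ * ∑ (cube k) g ≤ κ * (2 ^ a₀ * A + 2 ^ k * B) + E * (c * r ^ m)
    ∑-greedy with greedy-basis s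
    ... | bs , gr , spanning = ≤-trans (*-monoʳ-≤ κ (∑-⊆ g (cube-unique k) (λ {x} _ → spanning x))) (go (a₀ ≤? length bs))
      where
      open ≤-Reasoning
      ind = greedy⇒independent gr
      go : Dec (a₀ ≤ length bs) → κ * ∑ (span bs) g ≤ κ * (2 ^ a₀ * A + 2 ^ k * B) + E * (c * r ^ m)
      go (no a₀≰) = ≤-trans (*-monoʳ-≤ κ (begin
        ∑ (span bs) g               ≤⟨ ∑-span-≤A bs ⟩
        2 ^ length bs * A           ≤⟨ *-monoˡ-≤ A (^-monoʳ-≤ 2 (<⇒≤ (≰⇒> a₀≰))) ⟩
        2 ^ a₀ * A                  ≤⟨ m≤m+n _ _ ⟩
        2 ^ a₀ * A + 2 ^ k * B      ∎)) (m≤m+n _ _)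
      go (yes a₀≤) with ∑-span gr a₀≤
      ... | Q , bal , h = begin
        κ * ∑ (span bs) g                                        ≤⟨ *-monoʳ-≤ κ h ⟩
        κ * (2 ^ a₀ * A + 2 ^ length bs * B + E * Q)             ≡⟨ eq κ (2 ^ a₀ * A) (2 ^ length bs * B) E Q ⟩
        κ * (2 ^ a₀ * A + 2 ^ length bs * B) + E * (κ * Q)       ≤⟨ +-mono-≤ (*-monoʳ-≤ κ (+-monoʳ-≤ (2 ^ a₀ * A) (*-monoˡ-≤ B (^-monoʳ-≤ 2 (independent-length ind))))) (*-monoʳ-≤ E κQ≤) ⟩
        κ * (2 ^ a₀ * A + 2 ^ k * B) + E * (c * r ^ m)           ∎
        where
        eq : ∀ κ a b E Q → κ * (a + b + E * Q) ≡ κ * (a + b) + E * (κ * Q)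
        eq = solve-∀
        ℓ = length bs
        κQ≤ : κ * Q ≤ c * r ^ m
        -- For m = 0 the terms with 0 ^ m do not vanish, since 0 ^ 0 = 1. They are therefore
        -- compared by the hypothesis at a = ℓ and cancelled, uniformly in `m`.
        κQ≤ = ≤-trans (+-cancelʳ-≤ (c * ℓ ^ m * 0 ^ m) _ _ (begin
          κ * Q + c * ℓ ^ m * 0 ^ m                 ≡⟨ cong (κ * Q +_) (trans (*-assoc c _ _) (cong (c *_) (sym (*-distrib-^ ℓ 0 m)))) ⟩
          κ * Q + c * (ℓ * 0) ^ m                   ≤⟨ bal 0 (λ _ → z≤n) ⟩
          c * (∑ bs s) ^ m + κ * 2 ^ ℓ * 0 ^ m      ≤⟨ +-monoʳ-≤ _ (*-monoˡ-≤ (0 ^ m) (κ2^a≤ca^m ℓ a₀≤ (independent-length ind))) ⟩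
          c * (∑ bs s) ^ m + c * ℓ ^ m * 0 ^ m      ∎))
          (*-monoʳ-≤ c (^-monoˡ-≤ m (∑s≤r ind)))

-- Rank-one tensors in a subgroup

rank₁ : ∀ {D} → Vec (Vec Bool k) D → Vec Bool (k ^ D)
rank₁ []       = true ∷ []
rank₁ (x ∷ xs) = x ⊗ rank₁ xs

count₁ : ∀ k D → (Vec Bool (k ^ D) → Bool) → ℕ
count₁ k D V = ∑ (vecs D (cube k)) (λ R → ⟦ V (rank₁ R) ⟧)

count₁-suc : ∀ k D V → count₁ k (suc D) V ≡ ∑ (cube k) (λ x → count₁ k D (slice {k} V x))
count₁-suc k D V = ∑-vecs D (cube k) _

count₁-total : ∀ k D V → count₁ k D V ≤ (2 ^ k) ^ D
count₁-total k D V = ≤-trans (∑-mono (vecs D (cube k)) (λ R → ⟦⟧≤1 _))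
  (≤-reflexive (trans (∑-const (vecs D (cube k)) 1) (trans (*-identityʳ _)
    (trans (length-vecs D (cube k)) (cong (_^ D) (size-cube k))))))

module _ (k m a₀ : ℕ) (bound : ∀ a → a₀ ≤ a → a ≤ k → k ^ m * 2 ^ a ≤ 2 ^ k * a ^ m) where

  -- Division by 2^k (2^k)^D (k^m)^D gives the announced probability bound with D = d - 1. In the
  -- step every slice obeys the bound for `D`; `∑-greedy` averages the power term and contributes
  -- one more 2^a₀.
  count₁-≤ : ∀ D {V : Vec Bool (k ^ D) → Bool} → Subgroup V →
    2 ^ k * ((k ^ m) ^ D * count₁ k D V) ≤ (2 ^ k) ^ D * (D * 2 ^ a₀ * (k ^ m) ^ D + 2 ^ k * rank V ^ m)
  -- The empty tensor product is 1 ∈ 𝔽₂. If `V` contains it, then `V` has size 2 and rank 1, and 1 ^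
  -- m = 1 for every `m`.
  count₁-≤ zero {V} sg = begin
    2 ^ k * (1 * (⟦ V (true ∷ []) ⟧ + 0))    ≡⟨ cong (2 ^ k *_) (trans (*-identityˡ _) (+-identityʳ _)) ⟩
    2 ^ k * ⟦ V (true ∷ []) ⟧                ≤⟨ *-monoʳ-≤ (2 ^ k) (⟦V⟧≤ _ refl) ⟩
    2 ^ k * rank V ^ m                       ≡⟨ +-identityʳ _ ⟨
    1 * (2 ^ k * rank V ^ m)                 ∎
    where
    open ≤-Reasoning
    ⟦V⟧≤ : ∀ b → V (true ∷ []) ≡ b → ⟦ b ⟧ ≤ rank V ^ m
    ⟦V⟧≤ false eq = z≤n
    ⟦V⟧≤ true  eq = ≤-reflexive (sym (trans (cong (λ z → ⌊log₂ z ⌋ ^ m) size≡2) (^-zeroˡ m)))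
      where
      size≡2 : size V ≡ 2
      size≡2 rewrite 0∈ sg | eq = refl
  count₁-≤ (suc D) {V} sg = begin
    c * (κ * κ ^ D * count₁ k (suc D) V)
      ≡⟨ cong (λ z → c * (κ * κ ^ D * z)) (count₁-suc k D V) ⟩
    c * (κ * κ ^ D * ∑ (cube k) (λ x → count₁ k D (slice {k} V x)))
      ≡⟨ trans (e₀ c κ (κ ^ D) _) (cong (κ *_) (sym (∑-*ˡ (cube k) (c * κ ^ D) _))) ⟩
    κ * ∑ (cube k) g
      ≤⟨ ∑-greedy s m a₀ c κ bound g p q e (rank V) g≤A g≤ (∑-rank-slice {k} sg) ⟩
    κ * (β * p + c * q) + e * (c * rank V ^ m)
      ≡⟨ e₁ κ β c (c ^ D) (κ ^ D) D (rank V ^ m) ⟩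
    c * c ^ D * (suc D * β * (κ * κ ^ D) + c * rank V ^ m) ∎
    where
    open ≤-Reasoning
    c = 2 ^ k
    κ = k ^ m
    β = 2 ^ a₀
    s : Vec Bool k → ℕ
    s x = rank (slice {k} V x)
    g : Vec Bool k → ℕ
    g x = c * κ ^ D * count₁ k D (slice {k} V x)
    p = c * κ ^ D * c ^ D
    q = c ^ D * (D * β * κ ^ D)
    e = c ^ D * c
    e₀ : ∀ c κ K z → c * (κ * K * z) ≡ κ * (c * K * z)
    e₀ = solve-∀
    e₁ : ∀ κ β c C K D R → κ * (β * (c * K * C) + c * (C * (D * β * K))) + C * c * (c * R)
       ≡ c * C * (suc D * β * (κ * K) + c * R)
    e₁ = solve-∀
    g≤A : ∀ x → g x ≤ p
    g≤A x = *-monoʳ-≤ (c * κ ^ D) (count₁-total k D (slice {k} V x))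
    e₂ : ∀ C b c R → C * (b + c * R) ≡ C * b + C * c * R
    e₂ = solve-∀
    g≤ : ∀ x → g x ≤ q + e * s x ^ m
    g≤ x = begin
      g x                                            ≡⟨ *-assoc c _ _ ⟩
      c * (κ ^ D * count₁ k D (slice {k} V x))       ≤⟨ count₁-≤ D (slice-subgroup {k} sg x) ⟩
      c ^ D * (D * β * κ ^ D + c * s x ^ m)          ≡⟨ e₂ (c ^ D) _ c _ ⟩
      q + e * s x ^ m                                ∎

-- Moments of the bias

-- The rows are the `k` slices of the tensor along the first argument of the form.
allRows : ∀ k → (Vec Bool n → Bool) → Vec Bool (k * n) → Bool
allRows         zero    f T = true
allRows {n = n} (suc k) f T = f (take n T) ∧ allRows k f (drop n T)

∑-cube-++ : ∀ m n (f : Vec Bool (m + n) → ℕ) →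
  ∑ (cube (m + n)) f ≡ ∑ (cube m) (λ u → ∑ (cube n) (λ v → f (u Vec.++ v)))
∑-cube-++ zero    n f = sym (+-identityʳ _)
∑-cube-++ (suc m) n f = trans (∑-cube-suc (m + n) f)
  (trans (cong₂ _+_ (∑-cube-++ m n _) (∑-cube-++ m n _)) (sym (∑-cube-suc m _)))

∑-allRows : ∀ k (f : Vec Bool n → Bool) → ∑ (cube (k * n)) (λ T → ⟦ allRows k f T ⟧) ≡ size f ^ k
∑-allRows         zero    f = refl
∑-allRows {n = n} (suc k) f = begin
  ∑ (cube (n + k * n)) (λ T → ⟦ allRows (suc k) f T ⟧)
    ≡⟨ ∑-cube-++ n (k * n) _ ⟩
  ∑ (cube n) (λ u → ∑ (cube (k * n)) (λ v → ⟦ allRows (suc k) f (u Vec.++ v) ⟧))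
    ≡⟨ ∑-cong (cube n) (λ u → trans (∑-cong (cube (k * n)) (split u)) (∑-*ˡ (cube (k * n)) ⟦ f u ⟧ _)) ⟩
  ∑ (cube n) (λ u → ⟦ f u ⟧ * ∑ (cube (k * n)) (λ v → ⟦ allRows k f v ⟧))
    ≡⟨ ∑-*ʳ (cube n) _ _ ⟩
  size f * ∑ (cube (k * n)) (λ v → ⟦ allRows k f v ⟧)
    ≡⟨ cong (size f *_) (∑-allRows k f) ⟩
  size f * size f ^ k ∎
  where
  open ≡-Reasoning
  split : ∀ u v → ⟦ allRows (suc k) f (u Vec.++ v) ⟧ ≡ ⟦ f u ⟧ * ⟦ allRows k f v ⟧
  split u v with Vec.++-injective (take n (u Vec.++ v)) u (Vec.take++drop≡id n (u Vec.++ v))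
  ... | t , d rewrite t | d = ⟦⟧-∧ (f u) _

allRows-∧ : ∀ k (f g : Vec Bool n → Bool) T →
  ⟦ allRows k f T ⟧ * ⟦ allRows k g T ⟧ ≡ ⟦ allRows k (λ u → f u ∧ g u) T ⟧
allRows-∧         zero    f g T = refl
allRows-∧ {n = n} (suc k) f g T
  rewrite ⟦⟧-∧ (f (take n T)) (allRows k f (drop n T)) | ⟦⟧-∧ (g (take n T)) (allRows k g (drop n T))
        | ⟦⟧-∧ (f (take n T) ∧ g (take n T)) (allRows k (λ u → f u ∧ g u) (drop n T))
        | ⟦⟧-∧ (f (take n T)) (g (take n T)) | sym (allRows-∧ k f g (drop n T)) =
  ℕ*.interchange ⟦ f (take n T) ⟧ _ _ _

-- The number of choices of the last D arguments for which the form vanishes identically in the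
-- first; `biasSum≡zeros` relates it to the character sum.
zeros : ∀ k D → Vec Bool (k * k ^ D) → ℕ
zeros k D T = ∑ (vecs D (cube k)) (λ R → ⟦ allRows k (λ τ → not (dot τ (rank₁ R))) T ⟧)

-- `U` collects the linear conditions that already expanded factors impose on each slice. Starting
-- from the whole space, it lets the moment be computed one factor at a time.
moment : ∀ k D → ℕ → (Vec Bool (k ^ D) → Bool) → ℕ
moment k D t U = ∑ (cube (k * k ^ D)) (λ T → ⟦ allRows k U T ⟧ * (2 ^ k * zeros k D T) ^ t)

-- One factor of the power is expanded as a sum over R. The condition coming from R concerns each
-- slice separately, so it merges with membership in `U`.
moment-suc : ∀ k D t U → moment k D (suc t) U ≡
  2 ^ k * ∑ (vecs D (cube k)) (λ R → moment k D t (restrict U (rank₁ R)))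
moment-suc k D t U = begin
  ∑ Ts (λ T → ⟦ allRows k U T ⟧ * (c * zeros k D T * Z T))
    ≡⟨ ∑-cong Ts (λ T → trans (e₁ ⟦ allRows k U T ⟧ c _ (Z T)) (cong (λ z → c * (Z T * z)) (sym (∑-*ˡ Rs ⟦ allRows k U T ⟧ _)))) ⟩
  ∑ Ts (λ T → c * (Z T * ∑ Rs (λ R → ⟦ allRows k U T ⟧ * ⟦ allRows k (λ τ → not (dot τ (rank₁ R))) T ⟧)))
    ≡⟨ trans (∑-*ˡ Ts c _) (cong (c *_) (∑-cong Ts λ T → sym (∑-*ˡ Rs (Z T) _))) ⟩
  c * ∑ Ts (λ T → ∑ Rs (λ R → Z T * (⟦ allRows k U T ⟧ * ⟦ allRows k (λ τ → not (dot τ (rank₁ R))) T ⟧)))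
    ≡⟨ cong (c *_) (∑-swap Ts Rs _) ⟩
  c * ∑ Rs (λ R → ∑ Ts (λ T → Z T * (⟦ allRows k U T ⟧ * ⟦ allRows k (λ τ → not (dot τ (rank₁ R))) T ⟧)))
    ≡⟨ cong (c *_) (∑-cong Rs λ R → ∑-cong Ts λ T → trans (cong (Z T *_) (allRows-∧ k U _ T)) (*-comm (Z T) _)) ⟩
  c * ∑ Rs (λ R → moment k D t (restrict U (rank₁ R))) ∎
  where
  open ≡-Reasoning
  Ts = cube (k * k ^ D)
  Rs = vecs D (cube k)
  c = 2 ^ k
  Z : Vec Bool (k * k ^ D) → ℕ
  Z T = (c * zeros k D T) ^ t
  e₁ : ∀ a c z Z → a * (c * z * Z) ≡ c * (Z * (a * z))
  e₁ = solve-∀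

length-vecs-cube : ∀ k D → length (vecs D (cube k)) ≡ (2 ^ k) ^ D
length-vecs-cube k D = trans (length-vecs D (cube k)) (cong (_^ D) (size-cube k))

-- After division by 2^k (2^k)^D, `sparse` says Pr [X ∈ V] ≤ b / 2^k whenever dim V < t₀.
module _ (k D t₀ b : ℕ)
  (sparse : ∀ {V : Vec Bool (k ^ D) → Bool} → Subgroup V → 2 * size V ≤ 2 ^ t₀ →
            2 ^ k * count₁ k D V ≤ (2 ^ k) ^ D * b) where

  private
    c = 2 ^ k
    N = c ^ D

  -- A new R either halves `U`, a factor 2^(-k) over the k slices, or lies in the complement of `U`
  -- and changes nothing. The second case has probability at most b / 2^k, so the average factor is
  -- at most (1 + b) / 2^k.
  ∑-restrict : ∀ {U : Vec Bool (k ^ D) → Bool} → Subgroup U → 2 * size (perp U) ≤ 2 ^ t₀ →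
    2 ^ k * ∑ (vecs D (cube k)) (λ R → size (restrict U (rank₁ R)) ^ k) ≤ size U ^ k * (N * (1 + b))
  ∑-restrict {U} sg few = begin
    c * ∑ Rs (λ R → size (restrict U (rank₁ R)) ^ k)            ≡⟨ ∑-*ˡ Rs c _ ⟨
    ∑ Rs (λ R → c * size (restrict U (rank₁ R)) ^ k)            ≤⟨ ∑-mono Rs each ⟩
    ∑ Rs (λ R → size U ^ k * (1 + c * ⟦ perp U (rank₁ R) ⟧))    ≡⟨ ∑-*ˡ Rs (size U ^ k) _ ⟩
    size U ^ k * ∑ Rs (λ R → 1 + c * ⟦ perp U (rank₁ R) ⟧)      ≡⟨ cong (size U ^ k *_) (∑-+ Rs _ _) ⟩
    size U ^ k * (∑ Rs (λ _ → 1) + ∑ Rs (λ R → c * ⟦ perp U (rank₁ R) ⟧))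
      ≡⟨ cong (size U ^ k *_) (cong₂ _+_ (trans (∑-const Rs 1) (cong (_* 1) (length-vecs-cube k D))) (∑-*ˡ Rs c _)) ⟩
    size U ^ k * (N * 1 + c * count₁ k D (perp U))              ≤⟨ *-monoʳ-≤ (size U ^ k) (+-monoʳ-≤ (N * 1) (sparse (perp-subgroup U) few)) ⟩
    size U ^ k * (N * 1 + N * b)                                ≡⟨ cong (size U ^ k *_) (*-distribˡ-+ N 1 b) ⟨
    size U ^ k * (N * (1 + b))                                  ∎
    where
    open ≤-Reasoning
    Rs = vecs D (cube k)
    indicator : ∀ a → (1 + ⟦ a ⟧) ^ k ≤ 1 + c * ⟦ a ⟧
    indicator false = ≤-trans (≤-reflexive (^-zeroˡ k)) (m≤m+n 1 _)
    indicator true  = ≤-trans (≤-reflexive (sym (*-identityʳ c))) (m≤n+m _ 1)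
    each : ∀ R → c * size (restrict U (rank₁ R)) ^ k ≤ size U ^ k * (1 + c * ⟦ perp U (rank₁ R) ⟧)
    each R = begin
      c * size (restrict U (rank₁ R)) ^ k               ≡⟨ *-distrib-^ 2 _ k ⟨
      (2 * size (restrict U (rank₁ R))) ^ k             ≡⟨ cong (_^ k) (size-restrict sg (rank₁ R)) ⟩
      (size U * (1 + ⟦ perp U (rank₁ R) ⟧)) ^ k         ≡⟨ *-distrib-^ (size U) _ k ⟩
      size U ^ k * (1 + ⟦ perp U (rank₁ R) ⟧) ^ k       ≤⟨ *-monoʳ-≤ (size U ^ k) (indicator (perp U (rank₁ R))) ⟩
      size U ^ k * (1 + c * ⟦ perp U (rank₁ R) ⟧)       ∎

  -- `s` counts the conditions imposed so far, so `U` has codimension at most s, and by `size-perp`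
  -- its complement has size at most 2^s. While a factor remains, s < t₀, which is just what
  -- `sparse` asks for.
  moment-≤ : ∀ t s {U : Vec Bool (k ^ D) → Bool} → Subgroup U → 2 ^ (k ^ D) ≤ size U * 2 ^ s → s + t ≤ t₀ →
    moment k D t U ≤ size U ^ k * (N * (1 + b)) ^ t
  moment-≤ zero s {U} sg _ _ = ≤-reflexive (begin
    ∑ Ts (λ T → ⟦ allRows k U T ⟧ * 1)   ≡⟨ ∑-*ʳ Ts 1 _ ⟩
    ∑ Ts (λ T → ⟦ allRows k U T ⟧) * 1   ≡⟨ cong (_* 1) (∑-allRows k U) ⟩
    size U ^ k * 1                       ∎)
    where
    open ≡-Reasoning
    Ts = cube (k * k ^ D)
  moment-≤ (suc t) s {U} sg large s+t≤ = begin
    moment k D (suc t) U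
      ≡⟨ moment-suc k D t U ⟩
    c * ∑ Rs (λ R → moment k D t (restrict U (rank₁ R)))
      ≤⟨ *-monoʳ-≤ c (∑-mono Rs λ R → moment-≤ t (suc s) (restrict-subgroup sg (rank₁ R)) (large′ R) s′) ⟩
    c * ∑ Rs (λ R → size (restrict U (rank₁ R)) ^ k * W ^ t)
      ≡⟨ trans (cong (c *_) (∑-*ʳ Rs (W ^ t) _)) (sym (*-assoc c _ _)) ⟩
    c * ∑ Rs (λ R → size (restrict U (rank₁ R)) ^ k) * W ^ t
      ≤⟨ *-monoˡ-≤ (W ^ t) (∑-restrict sg few) ⟩
    size U ^ k * W * W ^ t
      ≡⟨ *-assoc (size U ^ k) _ _ ⟩
    size U ^ k * (W * W ^ t) ∎
    where
    open ≤-Reasoning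
    Rs = vecs D (cube k)
    W = N * (1 + b)
    s′ : suc s + t ≤ t₀
    s′ = subst (_≤ t₀) (+-suc s t) s+t≤
    large′ : ∀ R → 2 ^ (k ^ D) ≤ size (restrict U (rank₁ R)) * 2 ^ suc s
    large′ R = begin
      2 ^ (k ^ D)                                            ≤⟨ large ⟩
      size U * 2 ^ s                                         ≤⟨ *-monoˡ-≤ (2 ^ s) (m≤m*n (size U) (1 + ⟦ perp U (rank₁ R) ⟧)) ⟩
      size U * (1 + ⟦ perp U (rank₁ R) ⟧) * 2 ^ s            ≡⟨ cong (_* 2 ^ s) (size-restrict sg (rank₁ R)) ⟨
      2 * size (restrict U (rank₁ R)) * 2 ^ s                ≡⟨ e (size (restrict U (rank₁ R))) (2 ^ s) ⟩
      size (restrict U (rank₁ R)) * (2 * 2 ^ s)              ∎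
      where
      e : ∀ a b → 2 * a * b ≡ a * (2 * b)
      e = solve-∀
    few : 2 * size (perp U) ≤ 2 ^ t₀
    few = ≤-trans (*-monoʳ-≤ 2 (*-cancelˡ-≤ (size U) {{>-nonZero (1≤size sg)}} (≤-trans (size-perp sg) large)))
                  (^-monoʳ-≤ 2 (≤-trans (s≤s (m≤m+n s t)) s′))

  total-moment-≤ : ∑ (cube (k * k ^ D)) (λ T → (2 ^ k * zeros k D T) ^ t₀) ≤ 2 ^ (k * k ^ D) * (N * (1 + b)) ^ t₀
  total-moment-≤ = subst₂ _≤_
    (∑-cong (cube (k * k ^ D)) λ T → trans (cong (λ z → ⟦ z ⟧ * (2 ^ k * zeros k D T) ^ t₀) (allRows-true k T)) (*-identityˡ _))
    (cong (_* (N * (1 + b)) ^ t₀) (trans (cong (_^ k) size-everything) (trans (^-*-assoc 2 (k ^ D) k) (cong (2 ^_) (*-comm (k ^ D) k)))))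
    (moment-≤ t₀ 0 {everything} (record { 0∈ = refl ; ⊕∈ = λ _ _ → refl })
       (≤-reflexive (trans (sym size-everything) (sym (*-identityʳ _)))) ≤-refl)
    where
    everything : Vec Bool (k ^ D) → Bool
    everything _ = true
    size-everything : size everything ≡ 2 ^ (k ^ D)
    size-everything = trans (∑-cube-const (k ^ D) 1) (*-identityʳ _)
    allRows-true : ∀ j T → allRows j everything T ≡ true
    allRows-true zero    T = refl
    allRows-true (suc j) T = allRows-true j (drop (k ^ D) T)

-- Markov's inequality

-- The bias threshold 2^(-(1-p/q)k) can be irrational, so only its q-th power is compared. It is
-- enough to do this at a minimizer x of `f` on the event, where the number of events times f x is
-- at most the whole sum.
markov : ∀ (xs : List A) (P : A → Bool) (f : A → ℕ) q {a v} → 1 ≤ q →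
  (∀ x → P x ≡ true → a ≤ f x ^ q * v) → ∑ xs (λ x → ⟦ P x ⟧) ^ q * a ≤ ∑ xs f ^ q * v
markov {A = A} xs P f q {a} {v} 1≤q h with minimum xs
  where
  minimum : ∀ xs → ∑ xs (λ x → ⟦ P x ⟧) ≡ 0 ⊎ ∃ λ x → P x ≡ true × ∑ xs (λ x → ⟦ P x ⟧) * f x ≤ ∑ xs f
  minimum [] = inj₁ refl
  minimum (x ∷ xs) with P x in eq | minimum xs
  ... | false | inj₁ p            = inj₁ p
  ... | false | inj₂ (y , py , p) = inj₂ (y , py , ≤-trans p (m≤n+m _ _))
  ... | true  | inj₁ p            = inj₂ (x , eq , ≤-trans (≤-reflexive (trans (cong (λ z → suc z * f x) p) (*-identityˡ _))) (m≤m+n _ _))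
  ... | true  | inj₂ (y , py , p) with ≤-total (f x) (f y)
  ...   | inj₁ x≤y = inj₂ (x , eq , +-monoʳ-≤ (f x) (≤-trans (*-monoʳ-≤ (∑ xs (λ x → ⟦ P x ⟧)) x≤y) p))
  ...   | inj₂ y≤x = inj₂ (y , py , +-mono-≤ y≤x p)
markov xs P f (suc q) {a} 1≤q h | inj₁ p = subst (λ z → z ^ suc q * a ≤ _) (sym p) z≤n
markov xs P f q {a} {v} 1≤q h | inj₂ (x , px , p) = begin
  N ^ q * a                    ≤⟨ *-monoʳ-≤ (N ^ q) (h x px) ⟩
  N ^ q * (f x ^ q * v)        ≡⟨ *-assoc (N ^ q) _ _ ⟨
  N ^ q * f x ^ q * v          ≡⟨ cong (_* v) (*-distrib-^ N (f x) q) ⟨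
  (N * f x) ^ q * v            ≤⟨ *-monoˡ-≤ v (^-monoˡ-≤ q p) ⟩
  ∑ xs f ^ q * v               ∎
  where
  open ≤-Reasoning
  N = ∑ xs (λ x → ⟦ P x ⟧)

-- From lists of functions to lists of vectors

map-concatMap-map : ∀ {X Y Z W : Set} (f : Z → W) (h : X → Y → Z) (j : X → A) (g : A → B → W) (l : Y → B) xs ys →
  (∀ x y → f (h x y) ≡ g (j x) (l y)) →
  map f (concatMap (λ x → map (h x) ys) xs) ≡ cartesianProductWith g (map j xs) (map l ys)
map-concatMap-map f h j g l []       ys eq = refl
map-concatMap-map f h j g l (x ∷ xs) ys eq = trans (map-++ f (map (h x) ys) _)
  (cong₂ _++_ (trans (sym (map-∘ ys)) (trans (map-cong (eq x) ys) (map-∘ ys)))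
              (map-concatMap-map f h j g l xs ys eq))

-- The map `h` on values allows nested functions, such as the argument tuples in `biasSum`, to be
-- converted at both levels.
tabulate-allFuns : ∀ n (h : A → B) xs → map (λ x → tabulate (h ∘ x)) (allFuns n xs) ≡ vecs n (map h xs)
tabulate-allFuns zero    h xs = refl
tabulate-allFuns (suc n) h xs = trans
  (map-concatMap-map (λ x → tabulate (h ∘ x)) _ h _∷_ (λ x → tabulate (h ∘ x)) xs (allFuns n xs) (λ _ _ → refl))
  (cong (cartesianProductWith _∷_ (map h xs)) (tabulate-allFuns n h xs))

tabulate-allFuns-𝔽₂ : ∀ n → map tabulate (allFuns n 𝔽₂) ≡ cube n
tabulate-allFuns-𝔽₂ n = tabulate-allFuns n id 𝔽₂

-- The form as an inner product

xor-sum-++ : ∀ xs ys → sum𝔽₂ (xs ++ ys) ≡ sum𝔽₂ xs xor sum𝔽₂ ys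
xor-sum-++ []       ys = refl
xor-sum-++ (x ∷ xs) ys = trans (cong (x xor_) (xor-sum-++ xs ys)) (sym (Bool.xor-assoc x _ _))

xor-sum-∧ : ∀ b (f : A → Bool) xs → sum𝔽₂ (map (λ x → b ∧ f x) xs) ≡ b ∧ sum𝔽₂ (map f xs)
xor-sum-∧ b f []       = sym (Bool.∧-zeroʳ b)
xor-sum-∧ b f (x ∷ xs) = trans (cong ((b ∧ f x) xor_) (xor-sum-∧ b f xs)) (sym (Bool.∧-distribˡ-xor b (f x) _))

xor-sum-concatMap : ∀ (f : B → Bool) (g : A → List B) xs →
  sum𝔽₂ (map f (concatMap g xs)) ≡ sum𝔽₂ (map (λ x → sum𝔽₂ (map f (g x))) xs)
xor-sum-concatMap f g []       = refl
xor-sum-concatMap f g (x ∷ xs) = trans (cong sum𝔽₂ (map-++ f (g x) _))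
  (trans (xor-sum-++ (map f (g x)) _) (cong (sum𝔽₂ (map f (g x)) xor_) (xor-sum-concatMap f g xs)))

prod-allFin : ∀ d (h : Fin (suc d) → Bool) →
  prod𝔽₂ (map h (allFin (suc d))) ≡ h zero ∧ prod𝔽₂ (map (h ∘ suc) (allFin d))
prod-allFin d h = cong (λ z → h zero ∧ prod𝔽₂ z) (trans (map-tabulate suc h) (sym (map-tabulate id (h ∘ suc))))

-- `funToFin` splits off the first index by `combine`, so fixing that index at a leaves the tensor T
-- ∘ combine a. This is also how `rank₁` is built up by `_⊗_`.
form-suc : ∀ d k T x → form (suc d) k T x ≡
  sum𝔽₂ (map (λ a → x zero a ∧ form d k (T ∘ combine a) (x ∘ suc)) (allFin k))
form-suc d k T x = trans (xor-sum-concatMap summand _ (allFin k)) (cong sum𝔽₂ (map-cong row (allFin k)))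
  where
  summand : (Fin (suc d) → Fin k) → Bool
  summand i = entry (suc d) k T i ∧ prod𝔽₂ (map (λ j → x j (i j)) (allFin (suc d)))
  inner : Fin k → (Fin d → Fin k) → Bool
  inner a i = T (combine a (funToFin i)) ∧ prod𝔽₂ (map (λ j → x (suc j) (i j)) (allFin d))
  swap-∧ : ∀ a b c → a ∧ (b ∧ c) ≡ b ∧ (a ∧ c)
  swap-∧ true  b c = refl
  swap-∧ false b c = sym (Bool.∧-zeroʳ b)
  row : ∀ a → sum𝔽₂ (map summand (map _ (allFuns d (allFin k)))) ≡ x zero a ∧ form d k (T ∘ combine a) (x ∘ suc)
  row a = trans (cong sum𝔽₂ (trans (sym (map-∘ (allFuns d (allFin k))))
                  (map-cong (λ i → trans (cong (T (combine a (funToFin i)) ∧_) (prod-allFin d _))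
                                         (swap-∧ (T (combine a (funToFin i))) (x zero a) _)) (allFuns d (allFin k)))))
                (xor-sum-∧ (x zero a) (inner a) (allFuns d (allFin k)))

dot-++ : ∀ {m} (u v : Vec Bool m) (w z : Vec Bool n) → dot (u Vec.++ w) (v Vec.++ z) ≡ dot u v xor dot w z
dot-++ []      []      w z = refl
dot-++ (a ∷ u) (b ∷ v) w z = trans (cong ((a ∧ b) xor_) (dot-++ u v w z)) (sym (Bool.xor-assoc (a ∧ b) _ _))

tabulate-++ : ∀ m {n} (f : Fin (m + n) → A) → tabulate f ≡ tabulate (f ∘ (_↑ˡ n)) Vec.++ tabulate (f ∘ (m ↑ʳ_))
tabulate-++ zero    f = refl
tabulate-++ (suc m) f = cong (f zero ∷_) (tabulate-++ m (f ∘ suc))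

dot-tabulate-⊗ : ∀ k {n} (T : Fin (k * n) → Bool) (y : Fin k → Bool) (R : Vec Bool n) →
  dot (tabulate T) (tabulate y ⊗ R) ≡ sum𝔽₂ (map (λ a → y a ∧ dot (tabulate (T ∘ combine a)) R) (allFin k))
dot-tabulate-⊗ zero    T y R = refl
dot-tabulate-⊗ (suc k) {n} T y R = begin
  dot (tabulate T) (tabulate y ⊗ R)
    ≡⟨ cong (λ z → dot z (tabulate y ⊗ R)) (tabulate-++ n T) ⟩
  dot (tabulate (T ∘ (_↑ˡ (k * n))) Vec.++ tabulate (T ∘ (n ↑ʳ_))) ((y zero · R) Vec.++ (tabulate (y ∘ suc) ⊗ R))
    ≡⟨ dot-++ (tabulate (T ∘ (_↑ˡ (k * n)))) (y zero · R) _ _ ⟩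
  dot (tabulate (T ∘ (_↑ˡ (k * n)))) (y zero · R) xor dot (tabulate (T ∘ (n ↑ʳ_))) (tabulate (y ∘ suc) ⊗ R)
    ≡⟨ cong₂ _xor_ (dot-· (y zero) (tabulate (T ∘ combine {suc k} zero)) R) (dot-tabulate-⊗ k (T ∘ (n ↑ʳ_)) (y ∘ suc) R) ⟩
  F zero xor sum𝔽₂ (map (F ∘ suc) (allFin k))
    ≡⟨ cong (λ z → F zero xor sum𝔽₂ z) (trans (map-tabulate id (F ∘ suc)) (sym (map-tabulate suc F))) ⟩
  sum𝔽₂ (map F (allFin (suc k))) ∎
  where
  open ≡-Reasoning
  F : Fin (suc k) → Bool
  F a = y a ∧ dot (tabulate (T ∘ combine a)) R

form≡dot : ∀ d k T x → form d k T x ≡ dot (tabulate T) (rank₁ (tabulate (tabulate ∘ x)))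
form≡dot zero    k T x = refl
form≡dot (suc d) k T x = trans (form-suc d k T x) (trans
  (cong sum𝔽₂ (map-cong (λ a → cong (x zero a ∧_) (form≡dot d k (T ∘ combine a) (x ∘ suc))) (allFin k)))
  (sym (dot-tabulate-⊗ k T (x zero) (rank₁ (tabulate (tabulate ∘ x ∘ suc))))))

-- Character sums

∑ℤ : List A → (A → ℤ) → ℤ
∑ℤ xs f = sumℤ (map f xs)

∑ℤ-cong : ∀ (xs : List A) {f g : A → ℤ} → (∀ x → f x ≡ g x) → ∑ℤ xs f ≡ ∑ℤ xs g
∑ℤ-cong xs h = cong sumℤ (map-cong h xs)

∑ℤ-0 : ∀ (xs : List A) → ∑ℤ xs (λ _ → pos 0) ≡ pos 0
∑ℤ-0 []       = refl
∑ℤ-0 (x ∷ xs) = trans (ℤ.+-identityˡ _) (∑ℤ-0 xs)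

∑ℤ-+ : ∀ (xs : List A) (f g : A → ℤ) → ∑ℤ xs (λ x → f x ℤ.+ g x) ≡ ∑ℤ xs f ℤ.+ ∑ℤ xs g
∑ℤ-+ []       f g = refl
∑ℤ-+ (x ∷ xs) f g = trans (cong (λ z → f x ℤ.+ g x ℤ.+ z) (∑ℤ-+ xs f g)) (ℤ+.interchange (f x) (g x) _ _)

∑ℤ-swap : ∀ (xs : List A) (ys : List B) (f : A → B → ℤ) →
  ∑ℤ xs (λ x → ∑ℤ ys (f x)) ≡ ∑ℤ ys (λ y → ∑ℤ xs (λ x → f x y))
∑ℤ-swap []       ys f = sym (∑ℤ-0 ys)
∑ℤ-swap (x ∷ xs) ys f = trans (cong (λ z → ∑ℤ ys (f x) ℤ.+ z) (∑ℤ-swap xs ys f)) (sym (∑ℤ-+ ys (f x) _))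

∑ℤ-pos : ∀ (xs : List A) (f : A → ℕ) → ∑ℤ xs (λ x → pos (f x)) ≡ pos (∑ xs f)
∑ℤ-pos []       f = refl
∑ℤ-pos (x ∷ xs) f = trans (cong (λ z → pos (f x) ℤ.+ z) (∑ℤ-pos xs f)) (sym (ℤ.pos-+ (f x) _))

∑ℤ-++ : ∀ (xs ys : List A) (f : A → ℤ) → ∑ℤ (xs ++ ys) f ≡ ∑ℤ xs f ℤ.+ ∑ℤ ys f
∑ℤ-++ []       ys f = sym (ℤ.+-identityˡ _)
∑ℤ-++ (x ∷ xs) ys f = trans (cong (λ z → f x ℤ.+ z) (∑ℤ-++ xs ys f)) (sym (ℤ.+-assoc (f x) _ _))

∑ℤ-cartesianProductWith : ∀ (h : A → B → C) xs ys (f : C → ℤ) →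
  ∑ℤ (cartesianProductWith h xs ys) f ≡ ∑ℤ xs (λ x → ∑ℤ ys (f ∘ h x))
∑ℤ-cartesianProductWith h []       ys f = refl
∑ℤ-cartesianProductWith h (x ∷ xs) ys f = trans (∑ℤ-++ (map (h x) ys) _ f)
  (cong₂ ℤ._+_ (cong sumℤ (sym (map-∘ ys))) (∑ℤ-cartesianProductWith h xs ys f))

isZero : Vec Bool n → Bool
isZero []      = true
isZero (a ∷ u) = not a ∧ isZero u

sign-not : ∀ b → sign (not b) ≡ - sign b
sign-not false = refl
sign-not true  = refl

-- Orthogonality of characters: a coordinate `true` of `c` pairs the points x into opposite signs.
∑ℤ-sign-dot : ∀ (c : Vec Bool k) → ∑ℤ (cube k) (λ x → sign (dot c x)) ≡ pos (2 ^ k * ⟦ isZero c ⟧)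
∑ℤ-sign-dot []                    = refl
∑ℤ-sign-dot {k = suc k} (a ∷ c) = begin
  ∑ℤ (cube (suc k)) (λ x → sign (dot (a ∷ c) x))
    ≡⟨ ∑ℤ-cartesianProductWith _∷_ 𝔽₂ (cube k) _ ⟩
  ∑ℤ (cube k) (λ x → sign ((a ∧ false) xor dot c x)) ℤ.+ (∑ℤ (cube k) (λ x → sign ((a ∧ true) xor dot c x)) ℤ.+ pos 0)
    ≡⟨ cong₂ (λ b z → ∑ℤ (cube k) (λ x → sign (b xor dot c x)) ℤ.+ z) (Bool.∧-zeroʳ a)
        (trans (ℤ.+-identityʳ _) (cong (λ b → ∑ℤ (cube k) (λ x → sign (b xor dot c x))) (Bool.∧-identityʳ a))) ⟩
  ∑ℤ (cube k) (λ x → sign (dot c x)) ℤ.+ ∑ℤ (cube k) (λ x → sign (a xor dot c x))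
    ≡⟨ go a ⟩
  pos (2 ^ suc k * ⟦ isZero (a ∷ c) ⟧) ∎
  where
  open ≡-Reasoning
  double : ∀ p z → p * z + p * z ≡ 2 * p * z
  double = solve-∀
  go : ∀ a → ∑ℤ (cube k) (λ x → sign (dot c x)) ℤ.+ ∑ℤ (cube k) (λ x → sign (a xor dot c x))
       ≡ pos (2 ^ suc k * ⟦ isZero (a ∷ c) ⟧)
  go false = trans (cong₂ ℤ._+_ (∑ℤ-sign-dot c) (∑ℤ-sign-dot c))
    (trans (sym (ℤ.pos-+ (2 ^ k * ⟦ isZero c ⟧) _)) (cong pos (double (2 ^ k) ⟦ isZero c ⟧)))
  go true  = trans (sym (∑ℤ-+ (cube k) _ _)) (trans
    (∑ℤ-cong (cube k) λ x → trans (cong (λ z → sign (dot c x) ℤ.+ z) (sign-not (dot c x))) (ℤ.+-inverseʳ (sign (dot c x))))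
    (trans (∑ℤ-0 (cube k)) (cong pos (sym (*-zeroʳ (2 ^ suc k))))))

dot-⊗ : ∀ k {n} (T : Vec Bool (k * n)) (x : Vec Bool k) R → dot T (x ⊗ R) ≡ dot (contract k R T) x
dot-⊗ zero        []  []      R = refl
dot-⊗ (suc k) {n} T (b ∷ x) R = begin
  dot T ((b · R) Vec.++ (x ⊗ R))                                    ≡⟨ cong (λ z → dot z _) (Vec.take++drop≡id n T) ⟨
  dot (take n T Vec.++ drop n T) ((b · R) Vec.++ (x ⊗ R))           ≡⟨ dot-++ (take n T) _ _ _ ⟩
  dot (take n T) (b · R) xor dot (drop n T) (x ⊗ R)                 ≡⟨ cong₂ _xor_ (trans (dot-· b (take n T) R) (trans (cong (b ∧_) (dot-comm (take n T) R)) (Bool.∧-comm b _))) (dot-⊗ k (drop n T) x R) ⟩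
  (dot R (take n T) ∧ b) xor dot (contract k R (drop n T)) x        ∎
  where open ≡-Reasoning

isZero-contract : ∀ k {n} (T : Vec Bool (k * n)) R → isZero (contract k R T) ≡ allRows k (λ τ → not (dot τ R)) T
isZero-contract zero        T R = refl
isZero-contract (suc k) {n} T R = cong₂ _∧_ (cong not (dot-comm R (take n T))) (isZero-contract k (drop n T) R)

-- With the first argument summed innermost, the character sum detects whether all slices are
-- orthogonal to the tensor of the others. In particular the sum is nonnegative, so the absolute
-- value in the bias disappears.
biasSum≡zeros : ∀ D k (T : Tensor (suc D) k) → biasSum (suc D) k T ≡ pos (2 ^ k * zeros k D (tabulate T))
biasSum≡zeros D k T = begin
  ∑ℤ (allFuns (suc D) (allFuns k 𝔽₂)) (λ x → sign (form (suc D) k T x))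
    ≡⟨ ∑ℤ-cong (allFuns (suc D) (allFuns k 𝔽₂)) (λ x → cong sign (form≡dot (suc D) k T x)) ⟩
  ∑ℤ (allFuns (suc D) (allFuns k 𝔽₂)) (λ x → sign (dot τ (rank₁ (tabulate (tabulate ∘ x)))))
    ≡⟨ cong sumℤ (trans (map-∘ _) (cong (map _) (trans (tabulate-allFuns (suc D) tabulate (allFuns k 𝔽₂)) (cong (vecs (suc D)) (tabulate-allFuns-𝔽₂ k))))) ⟩
  ∑ℤ (vecs (suc D) (cube k)) (λ X → sign (dot τ (rank₁ X)))
    ≡⟨ ∑ℤ-cartesianProductWith _∷_ (cube k) Rs _ ⟩
  ∑ℤ (cube k) (λ x → ∑ℤ Rs (λ R → sign (dot τ (x ⊗ rank₁ R))))
    ≡⟨ ∑ℤ-swap (cube k) Rs _ ⟩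
  ∑ℤ Rs (λ R → ∑ℤ (cube k) (λ x → sign (dot τ (x ⊗ rank₁ R))))
    ≡⟨ ∑ℤ-cong Rs (λ R → trans (∑ℤ-cong (cube k) λ x → cong sign (dot-⊗ k τ x (rank₁ R))) (∑ℤ-sign-dot (contract k (rank₁ R) τ))) ⟩
  ∑ℤ Rs (λ R → pos (2 ^ k * ⟦ isZero (contract k (rank₁ R) τ) ⟧))
    ≡⟨ ∑ℤ-pos Rs _ ⟩
  pos (∑ Rs (λ R → 2 ^ k * ⟦ isZero (contract k (rank₁ R) τ) ⟧))
    ≡⟨ cong pos (trans (∑-*ˡ Rs (2 ^ k) _) (cong (2 ^ k *_) (∑-cong Rs λ R → cong ⟦_⟧ (isZero-contract k τ (rank₁ R))))) ⟩
  pos (2 ^ k * zeros k D τ) ∎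
  where
  open ≡-Reasoning
  τ  = tabulate T
  Rs = vecs D (cube k)

length-filterᵇ : ∀ (P : A → Bool) xs → length (filterᵇ P xs) ≡ ∑ xs (λ x → ⟦ P x ⟧)
length-filterᵇ P []       = refl
length-filterᵇ P (x ∷ xs) with P x
... | true  = cong suc (length-filterᵇ P xs)
... | false = length-filterᵇ P xs

count-biased : ∀ D k (P : ℕ → Bool) →
  length (filterᵇ (λ T → P ∣ biasSum (suc D) k T ∣) (allTensors (suc D) k))
    ≡ ∑ (cube (k ^ suc D)) (λ τ → ⟦ P (2 ^ k * zeros k D τ) ⟧)
count-biased D k P = begin
  length (filterᵇ (λ T → P ∣ biasSum (suc D) k T ∣) Ts)    ≡⟨ length-filterᵇ _ Ts ⟩
  ∑ Ts (λ T → ⟦ P ∣ biasSum (suc D) k T ∣ ⟧)               ≡⟨ ∑-cong Ts (λ T → cong (λ z → ⟦ P ∣ z ∣ ⟧) (biasSum≡zeros D k T)) ⟩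
  ∑ Ts (λ T → ⟦ P (2 ^ k * zeros k D (tabulate T)) ⟧)      ≡⟨ ∑-map tabulate Ts _ ⟨
  ∑ (map tabulate Ts) (λ τ → ⟦ P (2 ^ k * zeros k D τ) ⟧)  ≡⟨ cong (λ z → ∑ z (λ τ → ⟦ P (2 ^ k * zeros k D τ) ⟧)) (tabulate-allFuns-𝔽₂ (k ^ suc D)) ⟩
  ∑ (cube (k ^ suc D)) (λ τ → ⟦ P (2 ^ k * zeros k D τ) ⟧) ∎
  where
  open ≡-Reasoning
  Ts = allTensors (suc D) k

-- Comparing 2^(a-k) with (a / k)^m, and the choice of m

^-pos : ∀ x m → 1 ≤ x → 1 ≤ x ^ m
^-pos x m 1≤x = ≤-trans (≤-reflexive (sym (^-zeroˡ m))) (^-monoˡ-≤ m 1≤x)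

cancel-pos : ∀ {x y z} → 1 ≤ x → x * y ≤ x * z → y ≤ z
cancel-pos {x} 1≤x = *-cancelˡ-≤ x {{>-nonZero 1≤x}}

-- b ↦ (b + 1)ᵐ / bᵐ is decreasing, so a ↦ 2ᵏ⁻ᵃ aᵐ is unimodal and its minimum over
-- an interval is attained at an endpoint.
module _ (m : ℕ) where

  log-concave : ∀ b → b ^ m * suc (suc b) ^ m ≤ suc b ^ m * suc b ^ m
  log-concave b = subst₂ _≤_ (*-distrib-^ b _ m) (*-distrib-^ (suc b) _ m)
    (^-monoˡ-≤ m (≤-trans (n≤1+n _) (≤-reflexive (e b))))
    where
    e : ∀ b → suc (b * suc (suc b)) ≡ suc b * suc b
    e = solve-∀

  doubling-down : ∀ b → 2 * suc b ^ m ≤ suc (suc b) ^ m → 2 * b ^ m ≤ suc b ^ m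
  doubling-down b h = cancel-pos (^-pos (suc b) m (s≤s z≤n)) (begin
    suc b ^ m * (2 * b ^ m)      ≡⟨ e (suc b ^ m) (b ^ m) ⟩
    b ^ m * (2 * suc b ^ m)      ≤⟨ *-monoʳ-≤ (b ^ m) h ⟩
    b ^ m * suc (suc b) ^ m      ≤⟨ log-concave b ⟩
    suc b ^ m * suc b ^ m        ∎)
    where
    open ≤-Reasoning
    e : ∀ x y → x * (2 * y) ≡ y * (2 * x)
    e = solve-∀

  halving-up : ∀ b → 1 ≤ b → suc b ^ m ≤ 2 * b ^ m → suc (suc b) ^ m ≤ 2 * suc b ^ m
  halving-up b 1≤b h = cancel-pos (^-pos b m 1≤b) (begin
    b ^ m * suc (suc b) ^ m      ≤⟨ log-concave b ⟩
    suc b ^ m * suc b ^ m        ≤⟨ *-monoˡ-≤ (suc b ^ m) h ⟩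
    2 * b ^ m * suc b ^ m        ≡⟨ e (b ^ m) (suc b ^ m) ⟩
    b ^ m * (2 * suc b ^ m)      ∎)
    where
    open ≤-Reasoning
    e : ∀ x y → 2 * x * y ≡ x * (2 * y)
    e = solve-∀

  module _ (k : ℕ) where

    Above : ℕ → Set
    Above a = k ^ m * 2 ^ a ≤ 2 ^ k * a ^ m

    private
      e₁ : ∀ x y → x * (2 * y) ≡ 2 * (x * y)
      e₁ = solve-∀

    above-up : ∀ a₀ i → 2 * (a₀ + i) ^ m ≤ suc (a₀ + i) ^ m → Above a₀ → Above (a₀ + i)
    above-up a₀ zero    h ab = subst Above (sym (+-identityʳ a₀)) ab
    above-up a₀ (suc i) h ab = subst Above (sym (+-suc a₀ i)) (begin
      k ^ m * (2 * 2 ^ (a₀ + i))     ≡⟨ e₁ (k ^ m) _ ⟩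
      2 * (k ^ m * 2 ^ (a₀ + i))     ≤⟨ *-monoʳ-≤ 2 (above-up a₀ i h′ ab) ⟩
      2 * (2 ^ k * (a₀ + i) ^ m)     ≡⟨ e₁ (2 ^ k) _ ⟨
      2 ^ k * (2 * (a₀ + i) ^ m)     ≤⟨ *-monoʳ-≤ (2 ^ k) h′ ⟩
      2 ^ k * suc (a₀ + i) ^ m       ∎)
      where
      open ≤-Reasoning
      h′ : 2 * (a₀ + i) ^ m ≤ suc (a₀ + i) ^ m
      h′ = doubling-down (a₀ + i) (subst (λ z → 2 * z ^ m ≤ suc z ^ m) (+-suc a₀ i) h)

    above-down : ∀ a i → 1 ≤ a → suc a ^ m ≤ 2 * a ^ m → Above (a + i) → Above a
    above-down a zero    1≤a h ab = subst Above (+-identityʳ a) ab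
    above-down a (suc i) 1≤a h ab = cancel-pos {2} (s≤s z≤n) (begin
      2 * (k ^ m * 2 ^ a)       ≡⟨ e₁ (k ^ m) _ ⟨
      k ^ m * 2 ^ suc a         ≤⟨ above-down (suc a) i (s≤s z≤n) (halving-up a 1≤a h) (subst Above (+-suc a i) ab) ⟩
      2 ^ k * suc a ^ m         ≤⟨ *-monoʳ-≤ (2 ^ k) h ⟩
      2 ^ k * (2 * a ^ m)       ≡⟨ e₁ (2 ^ k) _ ⟩
      2 * (2 ^ k * a ^ m)       ∎)
      where open ≤-Reasoning

    -- The growth ratio at `a` selects the endpoint. If it is at least 2, the sequence has been
    -- rising since a₀; if it is at most 2, the sequence falls from `a` on to k, where `Above` is an
    -- equality.
    above-between : ∀ {a₀} → 1 ≤ a₀ → Above a₀ → ∀ a → a₀ ≤ a → a ≤ k → Above a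
    above-between {a₀} 1≤a₀ ab a a₀≤a a≤k with ≤-total (2 * a ^ m) (suc a ^ m)
    ... | inj₁ h with m≤n⇒∃[o]m+o≡n a₀≤a
    ...   | i , refl = above-up a₀ i h ab
    above-between 1≤a₀ ab a a₀≤a a≤k | inj₂ h with m≤n⇒∃[o]m+o≡n a≤k
    ...   | i , eq = above-down a i (≤-trans 1≤a₀ a₀≤a) h
      (subst Above (sym eq) (≤-reflexive (*-comm (k ^ m) _)))

n<2^n : ∀ n → n < 2 ^ n
n<2^n zero    = s≤s z≤n
n<2^n (suc n) = begin-strict
  suc n               <⟨ s≤s (n<2^n n) ⟩
  1 + 2 ^ n           ≤⟨ +-monoˡ-≤ (2 ^ n) (^-pos 2 n (s≤s z≤n)) ⟩
  2 ^ n + 2 ^ n       ≡⟨ cong (2 ^ n +_) (+-identityʳ _) ⟨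
  2 ^ suc n           ∎
  where open ≤-Reasoning

-- A substitute for the logarithm: ℓ + 1 is log₂ (k / a) rounded up.
dyadic : ∀ {a k} → 1 ≤ a → a < k → ∃ λ ℓ → 2 ^ ℓ * a < k × k ≤ 2 ^ suc ℓ * a
dyadic {a} {k} 1≤a a<k with go k
  where
  go : ∀ n → (∃ λ ℓ → 2 ^ ℓ * a < k × k ≤ 2 ^ suc ℓ * a) ⊎ 2 ^ n * a < k
  go zero = inj₂ (subst (_< k) (sym (*-identityˡ a)) a<k)
  go (suc n) with go n
  ... | inj₁ found = inj₁ found
  ... | inj₂ small with k ≤? 2 ^ suc n * a
  ...   | yes p = inj₁ (n , small , p)
  ...   | no  p = inj₂ (≰⇒> p)
... | inj₁ found = found
... | inj₂ small = contradiction small (≤⇒≯ (≤-trans (<⇒≤ (n<2^n k)) (m≤m*n (2 ^ k) a {{>-nonZero 1≤a}})))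

n²+3n≤3*2^n : ∀ n → n * n + 3 * n ≤ 3 * 2 ^ n
n²+3n≤3*2^n 0 = z≤n
n²+3n≤3*2^n 1 = m≤m+n 4 2
n²+3n≤3*2^n (suc n@(suc n′)) with n²+3n≤3*2^n n
n²+3n≤3*2^n (suc (suc zero))     | _ = m≤m+n 10 2
n²+3n≤3*2^n (suc n@(suc (suc j))) | ih = begin
  suc n * suc n + 3 * suc n                          ≤⟨ m≤m+n _ _ ⟩
  suc n * suc n + 3 * suc n + (2 + 5 * j + j * j)    ≡⟨ e j ⟩
  2 * (n * n + 3 * n)                                ≤⟨ *-monoʳ-≤ 2 ih ⟩
  2 * (3 * 2 ^ n)                                    ≡⟨ e′ (2 ^ n) ⟩
  3 * 2 ^ suc n                                      ∎
  where
  open ≤-Reasoning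
  e : ∀ j → (3 + j) * (3 + j) + 3 * (3 + j) + (2 + 5 * j + j * j) ≡ 2 * ((2 + j) * (2 + j) + 3 * (2 + j))
  e = solve-∀
  e′ : ∀ x → 2 * (3 * x) ≡ 3 * (2 * x)
  e′ = solve-∀

m<[1+m/n]*n : ∀ m n .{{_ : NonZero n}} → m < suc (m / n) * n
m<[1+m/n]*n m n = subst (_< suc (m / n) * n) (sym (m≡m%n+[m/n]*n m n)) (+-monoˡ-< (m / n * n) (m%n<n m n))

-- Rounding the quotient down loses at most ℓ, and ℓ ≤ 3 m because 2^ℓ ≤ k - a₀ makes ℓ logarithmic
-- in k - a₀. Together with the summand 1 in ℓ + 1 this is the 4 in 4 + ℓ.
exponent-bound : ∀ {k a₀} ℓ → 1 ≤ a₀ → 2 ^ ℓ * a₀ < k →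
  let m = (k ∸ a₀) / suc ℓ in k ≤ a₀ + (4 + ℓ) * m
exponent-bound {k} {a₀} ℓ 1≤a₀ small = begin
  k                           ≡⟨ m+[n∸m]≡n a₀≤k ⟨
  a₀ + x                      ≤⟨ +-monoʳ-≤ a₀ x≤ ⟩
  a₀ + (m * suc ℓ + ℓ)        ≤⟨ +-monoʳ-≤ a₀ (+-monoʳ-≤ (m * suc ℓ) ℓ≤3m) ⟩
  a₀ + (m * suc ℓ + 3 * m)    ≡⟨ cong (a₀ +_) (e m ℓ) ⟩
  a₀ + (4 + ℓ) * m            ∎
  where
  open ≤-Reasoning
  x = k ∸ a₀
  m = x / suc ℓ
  e : ∀ m ℓ → m * suc ℓ + 3 * m ≡ (4 + ℓ) * m
  e = solve-∀
  a₀≤k : a₀ ≤ k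
  a₀≤k = <⇒≤ (≤-<-trans (m≤n*m a₀ (2 ^ ℓ) {{>-nonZero (^-pos 2 ℓ (s≤s z≤n))}}) small)
  x≤ : x ≤ m * suc ℓ + ℓ
  x≤ = ≤-pred (≤-trans (m<[1+m/n]*n x (suc ℓ)) (≤-reflexive (e″ m ℓ)))
    where
    e″ : ∀ m ℓ → suc m * suc ℓ ≡ suc (m * suc ℓ + ℓ)
    e″ = solve-∀
  -- Since (2^ℓ - 1)(a₀ - 1) ≥ 0, one has a₀ + 2^ℓ ≤ 1 + 2^ℓ a₀ ≤ k.
  2^ℓ≤x : 2 ^ ℓ ≤ x
  2^ℓ≤x with m≤n⇒∃[o]m+o≡n (^-pos 2 ℓ (s≤s z≤n)) | m≤n⇒∃[o]m+o≡n 1≤a₀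
  ... | u , eq | v , refl = +-cancelˡ-≤ a₀ _ _ (begin
    a₀ + 2 ^ ℓ                ≡⟨ cong (a₀ +_) (sym eq) ⟩
    suc v + suc u             ≤⟨ m≤m+n _ _ ⟩
    suc v + suc u + u * v     ≡⟨ f u v ⟩
    suc (suc u * suc v)       ≡⟨ cong (λ z → suc (z * a₀)) eq ⟩
    suc (2 ^ ℓ * a₀)          ≤⟨ small ⟩
    k                         ≡⟨ m+[n∸m]≡n a₀≤k ⟨
    a₀ + x                    ∎)
    where
    f : ∀ u v → suc v + suc u + u * v ≡ suc (suc u * suc v)
    f = solve-∀
  ℓ≤3m : ℓ ≤ 3 * m
  ℓ≤3m with ℓ ≤? 3 * m
  ... | yes p = p
  ... | no  p = contradiction (begin
    suc ℓ + 3 * x                        ≤⟨ +-monoʳ-≤ (suc ℓ) (*-monoʳ-≤ 3 x≤) ⟩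
    suc ℓ + 3 * (m * suc ℓ + ℓ)          ≡⟨ f m ℓ ⟩
    suc (3 * m) * suc ℓ + 3 * ℓ          ≤⟨ +-monoˡ-≤ (3 * ℓ) (*-monoˡ-≤ (suc ℓ) (≰⇒> p)) ⟩
    ℓ * suc ℓ + 3 * ℓ                    ≡⟨ f′ ℓ ⟩
    ℓ + (ℓ * ℓ + 3 * ℓ)                  ≤⟨ +-monoʳ-≤ ℓ (n²+3n≤3*2^n ℓ) ⟩
    ℓ + 3 * 2 ^ ℓ                        ≤⟨ +-monoʳ-≤ ℓ (*-monoʳ-≤ 3 2^ℓ≤x) ⟩
    ℓ + 3 * x                            ∎) 1+n≰n
    where
    f : ∀ m ℓ → suc ℓ + 3 * (m * suc ℓ + ℓ) ≡ suc (3 * m) * suc ℓ + 3 * ℓ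
    f = solve-∀
    f′ : ∀ ℓ → ℓ * suc ℓ + 3 * ℓ ≡ ℓ + (ℓ * ℓ + 3 * ℓ)
    f′ = solve-∀

-- Rounding (k - a₀) / (ℓ + 1) down for `m` secures the comparison at a₀, because k / a₀ ≤ 2^(ℓ+1).
-- If r ≤ k^D / 2^(4+ℓ), then (r / k^D)^m ≤ 2^(-(4+ℓ)m) ≤ 2^(a₀-k) by `exponent-bound`: the power
-- term becomes one more copy of the exceptional term, whence `suc D`.
sparse-suc : ∀ k D a₀ → 1 ≤ a₀ → a₀ < k → ∃ λ ℓ → 2 ^ ℓ * a₀ < k ×
  ∀ r → r * 2 ^ (4 + ℓ) ≤ k ^ D → ∀ {V : Vec Bool (k ^ D) → Bool} → Subgroup V → size V ≤ 2 ^ r →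
  2 ^ k * count₁ k D V ≤ (2 ^ k) ^ D * (suc D * 2 ^ a₀)
sparse-suc k D a₀ 1≤a₀ a₀<k with dyadic 1≤a₀ a₀<k
... | ℓ , small , k≤ = ℓ , small , λ r r≤ {V} sg sizeV≤ →
  cancel-pos {κ ^ D} (^-pos κ D (^-pos k m (≤-trans (s≤s z≤n) a₀<k))) (begin
    κ ^ D * (c * count₁ k D V)                             ≡⟨ e₁ (κ ^ D) c _ ⟩
    c * (κ ^ D * count₁ k D V)                             ≤⟨ count₁-≤ k m a₀ (above-between m k 1≤a₀ above) D sg ⟩
    c ^ D * (D * β * κ ^ D + c * rank V ^ m)               ≤⟨ *-monoʳ-≤ (c ^ D) (+-monoʳ-≤ (D * β * κ ^ D) (rank-bound r r≤ (rank≤ sizeV≤))) ⟩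
    c ^ D * (D * β * κ ^ D + β * κ ^ D)                    ≡⟨ e₂ (c ^ D) D β (κ ^ D) ⟩
    κ ^ D * (c ^ D * (suc D * β))                          ∎)
  where
  open ≤-Reasoning
  m = (k ∸ a₀) / suc ℓ
  c = 2 ^ k
  κ = k ^ m
  β = 2 ^ a₀
  a₀≤k = <⇒≤ a₀<k
  e₁ : ∀ x y z → x * (y * z) ≡ y * (x * z)
  e₁ = solve-∀
  e₂ : ∀ C D β K → C * (D * β * K + β * K) ≡ K * (C * (suc D * β))
  e₂ = solve-∀
  above : Above m k a₀
  above = begin
    k ^ m * β                          ≤⟨ *-monoˡ-≤ β (^-monoˡ-≤ m k≤) ⟩
    (2 ^ suc ℓ * a₀) ^ m * β           ≡⟨ cong (_* β) (trans (*-distrib-^ (2 ^ suc ℓ) a₀ m) (cong (_* a₀ ^ m) (^-*-assoc 2 (suc ℓ) m))) ⟩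
    2 ^ (suc ℓ * m) * a₀ ^ m * β       ≤⟨ *-monoˡ-≤ β (*-monoˡ-≤ (a₀ ^ m) (^-monoʳ-≤ 2 (≤-trans (≤-reflexive (*-comm (suc ℓ) m)) (m/n*n≤m (k ∸ a₀) (suc ℓ))))) ⟩
    2 ^ (k ∸ a₀) * a₀ ^ m * β          ≡⟨ e₃ (2 ^ (k ∸ a₀)) (a₀ ^ m) β ⟩
    2 ^ (k ∸ a₀) * β * a₀ ^ m          ≡⟨ cong (_* a₀ ^ m) (trans (sym (^-distribˡ-+-* 2 (k ∸ a₀) a₀)) (cong (2 ^_) (m∸n+n≡m a₀≤k))) ⟩
    c * a₀ ^ m                         ∎
    where
    e₃ : ∀ x y z → x * y * z ≡ x * z * y
    e₃ = solve-∀
  rank≤ : ∀ {V : Vec Bool (k ^ D) → Bool} {r} → size V ≤ 2 ^ r → rank V ≤ r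
  rank≤ {r = r} p = ≤-trans (⌊log₂⌋-mono-≤ p) (≤-reflexive (⌊log₂[2^n]⌋≡n r))
  rank-bound : ∀ r → r * 2 ^ (4 + ℓ) ≤ k ^ D → ∀ {s} → s ≤ r → c * s ^ m ≤ β * κ ^ D
  rank-bound r r≤ {s} s≤r = begin
    c * s ^ m                                  ≤⟨ *-mono-≤ (^-monoʳ-≤ 2 (exponent-bound ℓ 1≤a₀ small)) (^-monoˡ-≤ m s≤r) ⟩
    2 ^ (a₀ + (4 + ℓ) * m) * r ^ m             ≡⟨ cong (_* r ^ m) (trans (^-distribˡ-+-* 2 a₀ _) (cong (β *_) (sym (^-*-assoc 2 (4 + ℓ) m)))) ⟩
    β * (2 ^ (4 + ℓ)) ^ m * r ^ m              ≡⟨ *-assoc β _ _ ⟩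
    β * ((2 ^ (4 + ℓ)) ^ m * r ^ m)            ≡⟨ cong (β *_) (trans (sym (*-distrib-^ (2 ^ (4 + ℓ)) r m)) (cong (_^ m) (*-comm (2 ^ (4 + ℓ)) r))) ⟩
    β * (r * 2 ^ (4 + ℓ)) ^ m                  ≤⟨ *-monoʳ-≤ β (^-monoˡ-≤ m r≤) ⟩
    β * (k ^ D) ^ m                            ≡⟨ cong (β *_) (trans (^-*-assoc k D m) (trans (cong (k ^_) (*-comm D m)) (sym (^-*-assoc k m D)))) ⟩
    β * κ ^ D                                  ∎

-- The tail bound and the choice of parameters

-- For ε = p / q and the character sum `S`, this is the q-th power of S / 2^(kd) ≥ 2^(-(1-ε)k),
-- cleared of denominators.
Biased : ∀ p q d k → ℕ → Bool
Biased p q d k S = 2 ^ (k * d * q + p * k) ≤ᵇ S ^ q * 2 ^ (q * k)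

#biased : ∀ p q D k → ℕ
#biased p q D k = ∑ (cube (k ^ suc D)) (λ τ → ⟦ Biased p q (suc D) k (2 ^ k * zeros k D τ) ⟧)

-- In probabilities: Pr ≤ ((1 + b) 2^(-εk))^t. `markov` is applied to the t-th power of the
-- character sum, and the common normalisation `K` cancels.
tail-bound : ∀ p q D k t b → 1 ≤ q →
  (∀ {V : Vec Bool (k ^ D) → Bool} → Subgroup V → 2 * size V ≤ 2 ^ t → 2 ^ k * count₁ k D V ≤ (2 ^ k) ^ D * b) →
  #biased p q D k ^ q * 2 ^ (p * k * t) ≤ 2 ^ (q * k ^ suc D) * (1 + b) ^ (q * t)
tail-bound p q D k t b 1≤q sparse = cancel-pos {K} (^-pos 2 (k * suc D * q * t) (s≤s z≤n)) (begin
  K * (N ^ q * 2 ^ (p * k * t))                        ≡⟨ e₁ K (N ^ q) _ ⟩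
  N ^ q * (K * 2 ^ (p * k * t))                        ≡⟨ cong (N ^ q *_) θ^t ⟨
  N ^ q * θ ^ t                                        ≤⟨ markov Ts (λ τ → Biased p q (suc D) k (S τ)) (λ τ → S τ ^ t) q 1≤q each ⟩
  ∑ Ts (λ τ → S τ ^ t) ^ q * v ^ t                     ≤⟨ *-monoˡ-≤ (v ^ t) (^-monoˡ-≤ q (total-moment-≤ k D t b sparse)) ⟩
  (2 ^ (k * k ^ D) * (Q * (1 + b)) ^ t) ^ q * v ^ t    ≡⟨ expand ⟩
  K * (2 ^ (q * k ^ suc D) * (1 + b) ^ (q * t))        ∎)
  where
  open ≤-Reasoning
  Ts = cube (k ^ suc D)
  S : Vec Bool (k ^ suc D) → ℕ
  S τ = 2 ^ k * zeros k D τ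
  N = #biased p q D k
  θ = 2 ^ (k * suc D * q + p * k)
  v = 2 ^ (q * k)
  Q = (2 ^ k) ^ D
  K = 2 ^ (k * suc D * q * t)
  e₁ : ∀ x y z → x * (y * z) ≡ y * (x * z)
  e₁ = solve-∀
  θ^t : θ ^ t ≡ K * 2 ^ (p * k * t)
  θ^t = trans (^-*-assoc 2 (k * suc D * q + p * k) t)
    (trans (cong (2 ^_) (*-distribʳ-+ t (k * suc D * q) (p * k))) (^-distribˡ-+-* 2 (k * suc D * q * t) _))
  each : ∀ τ → Biased p q (suc D) k (S τ) ≡ true → θ ^ t ≤ (S τ ^ t) ^ q * v ^ t
  each τ bi = begin
    θ ^ t                       ≤⟨ ^-monoˡ-≤ t (≤ᵇ⇒≤ θ _ (subst Data.Bool.T (sym bi) _)) ⟩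
    (S τ ^ q * v) ^ t           ≡⟨ *-distrib-^ (S τ ^ q) v t ⟩
    (S τ ^ q) ^ t * v ^ t       ≡⟨ cong (_* v ^ t) (trans (^-*-assoc (S τ) q t) (trans (cong (S τ ^_) (*-comm q t)) (sym (^-*-assoc (S τ) t q)))) ⟩
    (S τ ^ t) ^ q * v ^ t       ∎
  expand : (2 ^ (k * k ^ D) * (Q * (1 + b)) ^ t) ^ q * v ^ t ≡ K * (2 ^ (q * k ^ suc D) * (1 + b) ^ (q * t))
  expand = begin-equality
    (M * (Q * (1 + b)) ^ t) ^ q * v ^ t
      ≡⟨ cong (_* v ^ t) (*-distrib-^ M ((Q * (1 + b)) ^ t) q) ⟩
    M ^ q * ((Q * (1 + b)) ^ t) ^ q * v ^ t
      ≡⟨ cong₂ (λ x y → x * y * v ^ t) (trans (^-*-assoc 2 (k * k ^ D) q) (cong (2 ^_) (*-comm (k * k ^ D) q)))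
           (trans (^-*-assoc (Q * (1 + b)) t q) (trans (cong ((Q * (1 + b)) ^_) (*-comm t q)) (*-distrib-^ Q (1 + b) (q * t)))) ⟩
    2 ^ (q * k ^ suc D) * (Q ^ (q * t) * (1 + b) ^ (q * t)) * v ^ t
      ≡⟨ e₂ (2 ^ (q * k ^ suc D)) (Q ^ (q * t)) ((1 + b) ^ (q * t)) (v ^ t) ⟩
    Q ^ (q * t) * v ^ t * (2 ^ (q * k ^ suc D) * (1 + b) ^ (q * t))
      ≡⟨ cong (_* (2 ^ (q * k ^ suc D) * (1 + b) ^ (q * t))) powers ⟩
    K * (2 ^ (q * k ^ suc D) * (1 + b) ^ (q * t)) ∎
    where
    M = 2 ^ (k * k ^ D)
    e₂ : ∀ a c b v → a * (c * b) * v ≡ c * v * (a * b)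
    e₂ = solve-∀
    e₃ : ∀ k D q t → k * D * (q * t) + q * k * t ≡ k * suc D * q * t
    e₃ = solve-∀
    powers : Q ^ (q * t) * v ^ t ≡ K
    powers = trans (cong₂ _*_ (trans (cong (_^ (q * t)) (^-*-assoc 2 k D)) (^-*-assoc 2 (k * D) (q * t))) (^-*-assoc 2 (q * k) t))
      (trans (sym (^-distribˡ-+-* 2 (k * D * (q * t)) (q * k * t))) (cong (2 ^_) (e₃ k D q t)))

-- For ε > 1 the threshold exceeds 1, while a bias is at most 1.
no-biased : ∀ p q D k → q < p → 1 ≤ k → #biased p q D k ≡ 0
no-biased p q D k q<p 1≤k = trans (∑-cong (cube (k ^ suc D)) λ τ → cong ⟦_⟧ (not-biased τ))
    (trans (∑-cube-const (k ^ suc D) 0) (*-zeroʳ (2 ^ (k ^ suc D))))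
  where
  zeros≤ : ∀ τ → 2 ^ k * zeros k D τ ≤ 2 ^ (k * suc D)
  zeros≤ τ = begin
    2 ^ k * zeros k D τ                            ≤⟨ *-monoʳ-≤ (2 ^ k) (∑-mono Rs (λ R → ⟦⟧≤1 _)) ⟩
    2 ^ k * ∑ Rs (λ _ → 1)                         ≡⟨ cong (2 ^ k *_) (trans (∑-const Rs 1) (trans (*-identityʳ _) (length-vecs-cube k D))) ⟩
    (2 ^ k) ^ suc D                                ≡⟨ ^-*-assoc 2 k (suc D) ⟩
    2 ^ (k * suc D)                                ∎
    where
    open ≤-Reasoning
    Rs = vecs D (cube k)
  not-biased : ∀ τ → Biased p q (suc D) k (2 ^ k * zeros k D τ) ≡ false
  not-biased τ with Biased p q (suc D) k (2 ^ k * zeros k D τ) in eq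
  ... | false = refl
  ... | true  = contradiction (≤ᵇ⇒≤ (2 ^ (k * suc D * q + p * k)) _ (subst Data.Bool.T (sym eq) _)) (<⇒≱ (begin-strict
    (2 ^ k * zeros k D τ) ^ q * 2 ^ (q * k)        ≤⟨ *-monoˡ-≤ (2 ^ (q * k)) (^-monoˡ-≤ q (zeros≤ τ)) ⟩
    (2 ^ (k * suc D)) ^ q * 2 ^ (q * k)            ≡⟨ cong (_* 2 ^ (q * k)) (^-*-assoc 2 (k * suc D) q) ⟩
    2 ^ (k * suc D * q) * 2 ^ (q * k)              ≡⟨ ^-distribˡ-+-* 2 (k * suc D * q) (q * k) ⟨
    2 ^ (k * suc D * q + q * k)                    <⟨ ^-monoʳ-< 2 (s≤s (s≤s z≤n)) (+-monoʳ-< (k * suc D * q) (*-monoˡ-< k {{>-nonZero 1≤k}} q<p)) ⟩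
    2 ^ (k * suc D * q + p * k)                    ∎))
    where open ≤-Reasoning

-- Brings bounds obtained with different exponents `u` to the common exponent of the theorem, a
-- constant times q².
power-up : ∀ {N u x n′ v w y} → u * v ≡ w → y ≤ x * v → N ^ u * 2 ^ x ≤ 2 ^ (u * n′) →
  N ^ w * 2 ^ y ≤ 2 ^ (w * n′)
power-up {N} {u} {x} {n′} {v} {_} {y} refl y≤ h = begin
  N ^ (u * v) * 2 ^ y             ≤⟨ *-monoʳ-≤ (N ^ (u * v)) (^-monoʳ-≤ 2 y≤) ⟩
  N ^ (u * v) * 2 ^ (x * v)       ≡⟨ cong₂ _*_ (^-*-assoc N u v) (^-*-assoc 2 x v) ⟨
  (N ^ u) ^ v * (2 ^ x) ^ v       ≡⟨ *-distrib-^ (N ^ u) _ v ⟨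
  (N ^ u * 2 ^ x) ^ v             ≤⟨ ^-monoˡ-≤ v h ⟩
  (2 ^ (u * n′)) ^ v              ≡⟨ ^-*-assoc 2 (u * n′) v ⟩
  2 ^ (u * n′ * v)                ≡⟨ cong (2 ^_) (e u n′ v) ⟩
  2 ^ (u * v * n′)                ∎
  where
  open ≤-Reasoning
  e : ∀ a b c → a * b * c ≡ a * c * b
  e = solve-∀

1≤k : ∀ D e p k → suc D ^ e < 2 ^ (p * k) → 1 ≤ k
1≤k D e p zero    few = contradiction few (≤⇒≯ (≤-trans (≤-reflexive (cong (2 ^_) (*-zeroʳ p))) (^-pos (suc D) e (s≤s z≤n))))
1≤k D e p (suc k) _   = s≤s z≤n

-- For d = 1 the hypothesis on d only says p k > 0, which does not force a₀ ≥ 1. The first moment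
-- suffices here: a subgroup with 2 |V| ≤ 2 is zero and misses the empty product 1, so `sparse`
-- holds with b = 0.
biased-linear : ∀ p q k → 1 ≤ q → #biased p q 0 k ^ q * 2 ^ (p * k) ≤ 2 ^ (q * k ^ 1)
biased-linear p q k 1≤q = subst₂ _≤_
  (cong (λ z → #biased p q 0 k ^ q * 2 ^ z) (*-identityʳ (p * k)))
  (trans (cong (2 ^ (q * k ^ 1) *_) (^-zeroˡ (q * 1))) (*-identityʳ _))
  (tail-bound p q 0 k 1 0 1≤q sparse)
  where
  sparse : ∀ {V : Vec Bool 1 → Bool} → Subgroup V → 2 * size V ≤ 2 → 2 ^ k * count₁ k 0 V ≤ 0
  sparse {V} sg small = go (V (true ∷ [])) refl
    where
    size≡ : size V ≡ 1 + (⟦ V (true ∷ []) ⟧ + 0)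
    size≡ rewrite 0∈ sg = refl
    go : ∀ b → V (true ∷ []) ≡ b → 2 ^ k * (⟦ b ⟧ + 0) ≤ 0
    go false _  = ≤-reflexive (*-zeroʳ (2 ^ k))
    go true  eq = contradiction (subst (λ z → 2 * z ≤ 2) (trans size≡ (cong (λ z → 1 + (⟦ z ⟧ + 0)) eq)) small)
                                λ { (s≤s (s≤s ())) }

-- Here x is 2^ℓ. The 10 is 5 times a factor 2 lost in rounding a₀ down, the 16 is the 2^4 of
-- `exponent-bound`, and x a ≤ k comes from `dyadic`.
exponent-large : ∀ c → 80 ≤ c → ∀ p q a k K t x → p * k ≤ 10 * (q * a) → K ≤ t * (16 * x) → x * a ≤ k →
  p * (p * (k * K)) ≤ 2 * (p * k * t) * (c * q)
exponent-large c 80≤c p q a k K t x pk≤ K≤ xa≤k = begin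
  p * (p * (k * K))                         ≡⟨ cong (p *_) (*-assoc p k K) ⟨
  p * (p * k * K)                           ≤⟨ *-monoʳ-≤ p (*-mono-≤ pk≤ K≤) ⟩
  p * (10 * (q * a) * (t * (16 * x)))       ≡⟨ e 10 16 p q a t x ⟩
  10 * 16 * (p * q * t * (x * a))           ≤⟨ *-mono-≤ (*-monoʳ-≤ 2 80≤c) (*-monoʳ-≤ (p * q * t) xa≤k) ⟩
  2 * c * (p * q * t * k)                   ≡⟨ e′ c p q t k ⟩
  2 * (p * k * t) * (c * q)                 ∎
  where
  open ≤-Reasoning
  e : ∀ u v p q a t x → p * (u * (q * a) * (t * (v * x))) ≡ u * v * (p * q * t * (x * a))
  e = solve-∀
  e′ : ∀ c p q t k → 2 * c * (p * q * t * k) ≡ 2 * (p * k * t) * (c * q)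
  e′ = solve-∀

-- Of the exponent Y t, the share v / w pays for the factor W^t and the share u / w remains as the
-- gain.
absorb-factor : ∀ w u v {N W q Y t n} → u + v ≡ w → N ^ q * 2 ^ (Y * t) ≤ 2 ^ (q * n) * W ^ (q * t) →
  W ^ (w * q) ≤ 2 ^ (v * Y) → N ^ (w * q) * 2 ^ (u * (Y * t)) ≤ 2 ^ (w * q * n)
absorb-factor w u v {N} {W} {q} {Y} {t} {n} u+v≡w h W≤ = *-cancelʳ-≤ _ _ (2 ^ (v * (Y * t))) {{>-nonZero (^-pos 2 (v * (Y * t)) (s≤s z≤n))}} (begin
  N ^ (w * q) * 2 ^ (u * (Y * t)) * 2 ^ (v * (Y * t))     ≡⟨ *-assoc (N ^ (w * q)) _ _ ⟩
  N ^ (w * q) * (2 ^ (u * (Y * t)) * 2 ^ (v * (Y * t)))   ≡⟨ cong (N ^ (w * q) *_) (trans (sym (^-distribˡ-+-* 2 (u * (Y * t)) (v * (Y * t)))) (cong (2 ^_) exponents)) ⟩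
  N ^ (w * q) * 2 ^ (Y * t * w)                           ≡⟨ cong₂ _*_ (trans (^-*-assoc N q w) (cong (N ^_) (*-comm q w))) (^-*-assoc 2 (Y * t) w) ⟨
  (N ^ q) ^ w * (2 ^ (Y * t)) ^ w                         ≡⟨ *-distrib-^ (N ^ q) (2 ^ (Y * t)) w ⟨
  (N ^ q * 2 ^ (Y * t)) ^ w                               ≤⟨ ^-monoˡ-≤ w h ⟩
  (2 ^ (q * n) * W ^ (q * t)) ^ w                         ≡⟨ *-distrib-^ (2 ^ (q * n)) _ w ⟩
  (2 ^ (q * n)) ^ w * (W ^ (q * t)) ^ w
    ≡⟨ cong₂ _*_ (trans (^-*-assoc 2 (q * n) w) (cong (2 ^_) (e₁ q n w)))
                 (trans (^-*-assoc W (q * t) w) (trans (cong (W ^_) (e₁ q t w)) (sym (^-*-assoc W (w * q) t)))) ⟩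
  2 ^ (w * q * n) * (W ^ (w * q)) ^ t                     ≤⟨ *-monoʳ-≤ (2 ^ (w * q * n)) (^-monoˡ-≤ t W≤) ⟩
  2 ^ (w * q * n) * (2 ^ (v * Y)) ^ t                     ≡⟨ cong (2 ^ (w * q * n) *_) (trans (^-*-assoc 2 (v * Y) t) (cong (2 ^_) (*-assoc v Y t))) ⟩
  2 ^ (w * q * n) * 2 ^ (v * (Y * t))                     ∎)
  where
  open ≤-Reasoning
  e₁ : ∀ q n w → q * n * w ≡ w * q * n
  e₁ = solve-∀
  exponents : u * (Y * t) + v * (Y * t) ≡ Y * t * w
  exponents = trans (sym (*-distribʳ-+ (Y * t) u v)) (trans (cong (_* (Y * t)) u+v≡w) (*-comm w (Y * t)))

module _ (p q D k : ℕ) (1≤p : 1 ≤ p) (1≤q : 1 ≤ q) (p≤q : p ≤ q)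
         (few : (2 + D) ^ (5 * q) < 2 ^ (p * k)) where

  private
    d = 2 + D
    instance
      5q≢0 : NonZero (5 * q)
      5q≢0 = >-nonZero (≤-trans 1≤q (m≤n*m q 5))
    a₀ = p * k / (5 * q)

    -- As d ≥ 2, the hypothesis d^(5q) < 2^(pk) forces this; it is what makes a₀ at least 1.
    5q<pk : 5 * q < p * k
    5q<pk with 5 * q <? p * k
    ... | yes r = r
    ... | no  r = contradiction few (≤⇒≯ (≤-trans (^-monoʳ-≤ 2 (≮⇒≥ r)) (^-monoˡ-≤ (5 * q) (s≤s (s≤s z≤n)))))

    a₀5q≤ : a₀ * (5 * q) ≤ p * k
    a₀5q≤ = m/n*n≤m (p * k) (5 * q)

    1≤a₀ : 1 ≤ a₀
    1≤a₀ with a₀ | m<[1+m/n]*n (p * k) (5 * q)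
    ... | zero  | h = contradiction h (<⇒≯ (subst (_< p * k) (sym (*-identityˡ (5 * q))) 5q<pk))
    ... | suc _ | _ = s≤s z≤n

    a₀<k : a₀ < k
    a₀<k = *-cancelʳ-< q a₀ k (begin-strict
      a₀ * q            <⟨ *-monoʳ-< a₀ {{>-nonZero 1≤a₀}} (m<m*n q 5 {{>-nonZero 1≤q}} (s≤s (s≤s z≤n))) ⟩
      a₀ * (q * 5)      ≡⟨ cong (a₀ *_) (*-comm q 5) ⟩
      a₀ * (5 * q)      ≤⟨ a₀5q≤ ⟩
      p * k             ≤⟨ *-monoˡ-≤ k p≤q ⟩
      q * k             ≡⟨ *-comm q k ⟩
      k * q             ∎)
      where open ≤-Reasoning

    b = d * 2 ^ a₀

    -- Again by d ≥ 2, 1 + b ≤ d b = d · d · 2^a₀, and the 5q-th power of each of the three factors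
    -- is at most 2^(pk). So three fifths of εk are spent.
    [1+b]^5q≤ : (1 + b) ^ (5 * q) ≤ 2 ^ (3 * (p * k))
    [1+b]^5q≤ = begin
      (1 + b) ^ (5 * q)                                        ≤⟨ ^-monoˡ-≤ (5 * q) 1+b≤ ⟩
      (d * (d * 2 ^ a₀)) ^ (5 * q)                             ≡⟨ trans (*-distrib-^ d _ (5 * q)) (cong (d ^ (5 * q) *_) (*-distrib-^ d (2 ^ a₀) (5 * q))) ⟩
      d ^ (5 * q) * (d ^ (5 * q) * (2 ^ a₀) ^ (5 * q))         ≤⟨ *-mono-≤ (<⇒≤ few) (*-mono-≤ (<⇒≤ few) (≤-trans (≤-reflexive (^-*-assoc 2 a₀ (5 * q))) (^-monoʳ-≤ 2 a₀5q≤))) ⟩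
      2 ^ (p * k) * (2 ^ (p * k) * 2 ^ (p * k))                ≡⟨ cong (2 ^ (p * k) *_) (^-distribˡ-+-* 2 (p * k) (p * k)) ⟨
      2 ^ (p * k) * 2 ^ (p * k + p * k)                        ≡⟨ ^-distribˡ-+-* 2 (p * k) _ ⟨
      2 ^ (p * k + (p * k + p * k))                            ≡⟨ cong (λ z → 2 ^ (p * k + (p * k + z))) (+-identityʳ (p * k)) ⟨
      2 ^ (3 * (p * k))                                        ∎
      where
      open ≤-Reasoning
      1≤b : 1 ≤ b
      1≤b = ≤-trans (s≤s z≤n) (m≤m*n d (2 ^ a₀) {{>-nonZero (^-pos 2 a₀ (s≤s z≤n))}})
      1+b≤ : 1 + b ≤ d * b
      1+b≤ = ≤-trans (+-monoˡ-≤ b 1≤b) (≤-trans (≤-reflexive (cong (b +_) (sym (+-identityʳ b)))) (*-monoˡ-≤ b {2} {d} (s≤s (s≤s z≤n))))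

  -- With ε = p / q one has a₀ ≈ ε k / 5 and 2^ℓ ≈ k / a₀, so t ≈ k^(d-1) / 2^(4+ℓ) is at least
  -- ε k^(d-1) / 160; this is where the constant 400 = 5 · 80 comes from.
  biased-multilinear : ∀ c → 80 ≤ c → ∃ λ t → p * (p * k ^ d) ≤ 2 * (p * k * t) * (c * q) ×
    #biased p q (suc D) k ^ (5 * q) * 2 ^ (2 * (p * k * t)) ≤ 2 ^ (5 * q * k ^ d)
  biased-multilinear c 80≤c = t , large , absorb-factor 5 2 3 {#biased p q (suc D) k} {1 + b} {q} {p * k} {t} {k ^ d} refl
      (tail-bound p q (suc D) k t b 1≤q λ sg sz → sparse r (m/n*n≤m (k ^ suc D) w) sg (*-cancelˡ-≤ 2 sz))
      [1+b]^5q≤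
    where
    open ≤-Reasoning
    scale = sparse-suc k (suc D) a₀ 1≤a₀ a₀<k
    ℓ = proj₁ scale
    small = proj₁ (proj₂ scale)
    sparse = proj₂ (proj₂ scale)
    w = 2 ^ (4 + ℓ)
    instance
      w≢0 : NonZero w
      w≢0 = >-nonZero (^-pos 2 (4 + ℓ) (s≤s z≤n))
    r = k ^ suc D / w
    -- One more than `r`, so that the condition 2 |V| ≤ 2^t becomes |V| ≤ 2^r, and so that t 2^(4+ℓ)
    -- exceeds k^(d-1) in spite of the rounding.
    t = suc r
    pk≤10qa₀ : p * k ≤ 10 * (q * a₀)
    pk≤10qa₀ = begin
      p * k                        ≤⟨ <⇒≤ (m<[1+m/n]*n (p * k) (5 * q)) ⟩
      suc a₀ * (5 * q)             ≤⟨ *-monoˡ-≤ (5 * q) (+-monoˡ-≤ a₀ 1≤a₀) ⟩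
      (a₀ + a₀) * (5 * q)          ≡⟨ e a₀ q ⟩
      10 * (q * a₀)                ∎
      where
      e : ∀ a q → (a + a) * (5 * q) ≡ 10 * (q * a)
      e = solve-∀
    large : p * (p * k ^ d) ≤ 2 * (p * k * t) * (c * q)
    large = exponent-large c 80≤c p q a₀ k (k ^ suc D) t (2 ^ ℓ) pk≤10qa₀
      (subst (λ z → k ^ suc D ≤ t * z) (^-distribˡ-+-* 2 4 ℓ) (<⇒≤ (m<[1+m/n]*n (k ^ suc D) w)))
      (<⇒≤ small)

#biased-≤ : ∀ c → 80 ≤ c → ∀ p q D k → 1 ≤ p → 1 ≤ q → suc D ^ (5 * q) < 2 ^ (p * k) →
  #biased p q D k ^ (5 * c * (q * q)) * 2 ^ (1 * (p * p) * k ^ suc D) ≤ 2 ^ (5 * c * (q * q) * k ^ suc D)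
#biased-≤ c 80≤c p q D k 1≤p 1≤q few = go (p ≤? q) D few
  where
  open ≤-Reasoning
  1≤5c : 1 ≤ 5 * c
  1≤5c = *-mono-≤ {1} {5} {1} {c} (s≤s z≤n) (≤-trans (s≤s z≤n) 80≤c)
  0^ : ∀ n → 1 ≤ n → 0 ^ n ≡ 0
  0^ (suc n) _ = refl
  e₁ : ∀ c q → q * (5 * c * q) ≡ 5 * c * (q * q)
  e₁ = solve-∀
  e₂ : ∀ p n → 1 * (p * p) * n ≡ p * n * p
  e₂ = solve-∀
  e₃ : ∀ c q → 5 * q * (c * q) ≡ 5 * c * (q * q)
  e₃ = solve-∀
  e₄ : ∀ p n → 1 * (p * p) * n ≡ p * (p * n)
  e₄ = solve-∀
  go : Dec (p ≤ q) → ∀ D → suc D ^ (5 * q) < 2 ^ (p * k) →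
    #biased p q D k ^ (5 * c * (q * q)) * 2 ^ (1 * (p * p) * k ^ suc D) ≤ 2 ^ (5 * c * (q * q) * k ^ suc D)
  go (no p≰q) D few = begin
    #biased p q D k ^ (5 * c * (q * q)) * 2 ^ (1 * (p * p) * k ^ suc D)
      ≡⟨ cong (λ N → N ^ (5 * c * (q * q)) * 2 ^ (1 * (p * p) * k ^ suc D)) (no-biased p q D k (≰⇒> p≰q) (1≤k D (5 * q) p k few)) ⟩
    0 ^ (5 * c * (q * q)) * 2 ^ (1 * (p * p) * k ^ suc D)
      ≡⟨ cong (_* 2 ^ (1 * (p * p) * k ^ suc D)) (0^ (5 * c * (q * q)) (*-mono-≤ {1} {5 * c} 1≤5c (*-mono-≤ 1≤q 1≤q))) ⟩
    0
      ≤⟨ z≤n ⟩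
    2 ^ (5 * c * (q * q) * k ^ suc D) ∎
  go (yes p≤q) zero few = power-up {#biased p q 0 k} {q} {p * k} {k ^ 1} {5 * c * q} (e₁ c q) (begin
    1 * (p * p) * k ^ 1         ≡⟨ e₂ p (k ^ 1) ⟩
    p * k ^ 1 * p               ≤⟨ *-monoʳ-≤ (p * k ^ 1) (≤-trans p≤q (m≤n*m q (5 * c) {{>-nonZero 1≤5c}})) ⟩
    p * k ^ 1 * (5 * c * q)     ≡⟨ cong (λ z → p * z * (5 * c * q)) (*-identityʳ k) ⟩
    p * k * (5 * c * q)         ∎) (biased-linear p q k 1≤q)
  go (yes p≤q) (suc D) few = power-up {#biased p q (suc D) k} {5 * q} {2 * (p * k * proj₁ multilinear)} {k ^ suc (suc D)} {c * q} (e₃ c q)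
    (≤-trans (≤-reflexive (e₄ p (k ^ suc (suc D)))) (proj₁ (proj₂ multilinear))) (proj₂ (proj₂ multilinear))
    where multilinear = biased-multilinear p q D k 1≤p 1≤q p≤q few c 80≤c

theorem3p2 : Σ ℕ λ a → Σ ℕ λ b → (1 ≤ a) × (1 ≤ b) ×
    ((p q d k : ℕ) → 1 ≤ p → 1 ≤ q → 1 ≤ d →
    d ^ (5 * q) < 2 ^ (p * k) →
    length (filterᵇ (λ T → 2 ^ (k * d * q + p * k) ≤ᵇ ∣ biasSum d k T ∣ ^ q * 2 ^ (q * k))
    (allTensors d k))
    ^ (b * (q * q)) * 2 ^ (a * (p * p) * k ^ d)
    ≤ 2 ^ (b * (q * q) * k ^ d))
theorem3p2 = 1 , 400 , s≤s z≤n , s≤s z≤n , bound 400 refl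
  where
  -- A variable stands for 400, so that products with this numeral stay folded in the exponents.
  bound : ∀ b → b ≡ 5 * 80 → (p q d k : ℕ) → 1 ≤ p → 1 ≤ q → 1 ≤ d → d ^ (5 * q) < 2 ^ (p * k) →
    length (filterᵇ (λ T → 2 ^ (k * d * q + p * k) ≤ᵇ ∣ biasSum d k T ∣ ^ q * 2 ^ (q * k)) (allTensors d k))
    ^ (b * (q * q)) * 2 ^ (1 * (p * p) * k ^ d) ≤ 2 ^ (b * (q * q) * k ^ d)
  bound b b≡ p q (suc D) k 1≤p 1≤q _ few =
    subst₂ (λ N b → N ^ (b * (q * q)) * 2 ^ (1 * (p * p) * k ^ suc D) ≤ 2 ^ (b * (q * q) * k ^ suc D))
      (sym (count-biased D k (Biased p q (suc D) k))) (sym b≡) (#biased-≤ 80 ≤-refl p q D k 1≤p 1≤q few)
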